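{- Let $G=(V,E)$ be a graph with a multiset $R=\{r_1,\dots,r_t\}$ of vertices of $V$, and let $\mathcal{M}$ be a matroid on $R$ of rank $k$ with rank function $r_{\mathcal{M}}:2^{R}\to\mathbb{Z}$. Then $(G,R)$ admits a basic rooted-tree decomposition with respect to $\mathcal{M}$ if and only if the following three conditions hold: (C1) $R_v$ is independent in $\mathcal{M}$ for each $v\in V$; (C2) $|F|+|R_F|\le k|V(F)|-k+r_{\mathcal{M}}(R_F)$ for every non-empty $F\subseteq E$; (C3) $|E|+|R|=k|V|$.
   Context: Graphs are finite and undirected. For $F\subseteq E$, $V(F)$ is the set of vertices incident to edges of $F$. The multiset $R=\{r_1,\dots,r_t\}$ is regarded as a family indexed by $1,\dots,t$ (different indices are different elements of $R$, even if they are the same vertex of $V$); a matroid on $R$ has these $t$ elements as ground set, and cardinalities of sub-multisets count multiplicity. For $v\in V$, $R_v=\{r_i\in R\mid r_i=v\}$, and for $F\subseteq E$, $R_F=\{r_i\in R\mid r_i\in V(F)\}$, as multi-subsets of $R$. A pair $(T,r)$ with $T\subseteq E$, $r\in V$ is a rooted-tree if either $T=\emptyset$, or $T$ is connected without cycles and $r\in V(T)$. Put $V(T,r)=V(T)\cup\{r\}$ (so $V(\emptyset,r)=\{r\}$). $(G,R)$ admits a basic rooted-tree decomposition with respect to $\mathcal{M}$ if $E$ can be partitioned into pairwise disjoint sets $T_1,\dots,T_t$ (where $T_i=\emptyset$ is allowed) such that each $(T_i,r_i)$ is a rooted-tree and, for each $v\in V$, the multiset $\{r_i\in R\mid v\in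 V(T_i,r_i)\}$ is a base of $\mathcal{M}$. -}

module Defs where

open import Data.Nat.Base using (ℕ; suc; _<_)
open import Data.Nat.Properties using () renaming (_≟_ to _≟ℕ_)
open import Data.Fin.Base using (Fin)
open import Data.Fin.Properties using (_≟_; any?)
open import Data.Fin.Subset
open import Data.Fin.Subset.Properties using (_∈?_; _⊆?_; anySubset?)
open import Data.List.Base using (List; []; _∷_; filter; upTo)
open import Data.List.Extrema.Nat using (max)
open import Data.List.Relation.Unary.Unique.Propositional using (Unique)
open import Data.Product.Base using (Σ-syntax; ∃-syntax; _×_; _,_; proj₁; proj₂)
open import Data.Sum.Base using (_⊎_)
open import Data.Vec.Base using (tabulate)
open import Relation.Binary.PropositionalEquality.Core using (_≡_; _≢_)
open import Relation.Nullary using (Dec; ¬_; does; _×-dec_; _⊎-dec_)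
open import Relation.Unary using (Decidable)

subsetOf : ∀ {n} {P : Fin n → Set} → Decidable P → Subset n
subsetOf P? = tabulate (λ x → does (P? x))

-- Independence is required to be decidable: classically this is no
-- restriction (the ground set is finite), and constructively it is what lets
-- `Indep` stand for an actual family of finite subsets.
record Matroid (t : ℕ) : Set₁ where
  field
    Indep   : Subset t → Set
    indep?  : Decidable Indep
    empty   : Indep ⊥
    closed  : ∀ {I J} → I ⊆ J → Indep J → Indep I
    augment : ∀ {I J} → Indep I → Indep J → ∣ I ∣ < ∣ J ∣ →
              ∃[ x ] x ∈ J × x ∉ I × Indep (I ∪ ⁅ x ⁆)

  IsBase : Subset t → Set
  IsBase B = Indep B × (∀ I → Indep I → B ⊆ I → I ⊆ B)

  HasIndepOfSize : Subset t → ℕ → Set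
  HasIndepOfSize S j = ∃[ I ] I ⊆ S × Indep I × ∣ I ∣ ≡ j

  hasIndepOfSize? : ∀ S → Decidable (HasIndepOfSize S)
  hasIndepOfSize? S j =
    anySubset? (λ I → (I ⊆? S) ×-dec (indep? I ×-dec (∣ I ∣ ≟ℕ j)))

  -- The largest size of an independent subset of S.  Sizes are searched for
  -- among 0 , … , t, and the default value 0 is attained by ⊥.
  rank : Subset t → ℕ
  rank S = max 0 (filter (hasIndepOfSize? S) (upTo (suc t)))

-- Finite undirected multigraphs; loops and parallel edges are allowed, and the
-- order of the two ends of an edge is irrelevant to everything below.
record Graph : Set where
  field
    #V #E : ℕ
    ends  : Fin #E → Fin #V × Fin #V

  Vertex Edge : Set
  Vertex = Fin #V
  Edge   = Fin #E

  Incident : Vertex → Edge → Set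
  Incident v e = v ≡ proj₁ (ends e) ⊎ v ≡ proj₂ (ends e)

  incident? : ∀ v e → Dec (Incident v e)
  incident? v e = (v ≟ proj₁ (ends e)) ⊎-dec (v ≟ proj₂ (ends e))

  Joins : Edge → Vertex → Vertex → Set
  Joins e u v = ends e ≡ (u , v) ⊎ ends e ≡ (v , u)

  V⟨_⟩ : Subset #E → Subset #V
  V⟨ F ⟩ = subsetOf (λ v → any? (λ e → (e ∈? F) ×-dec incident? v e))

  data Walk (F : Subset #E) : Vertex → Vertex → Set where
    stop : ∀ {u} → Walk F u u
    step : ∀ {u v w} (e : Edge) → e ∈ F → Joins e u v → Walk F v w → Walk F u w

  edges : ∀ {F u v} → Walk F u v → List Edge
  edges stop           = []
  edges (step e _ _ w) = e ∷ edges w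

  -- Every vertex visited except the last one.
  startVertices : ∀ {F u v} → Walk F u v → List Vertex
  startVertices stop                   = []
  startVertices (step {u = u} _ _ _ w) = u ∷ startVertices w

  -- Distinctness of the edges excludes walking back along the same edge, while
  -- a loop and a pair of parallel edges are cycles of length 1 and 2.
  IsCycle : ∀ {F v} → Walk F v v → Set
  IsCycle w = edges w ≢ [] × Unique (edges w) × Unique (startVertices w)

  Connected : Subset #E → Set
  Connected F = ∀ {u v} → u ∈ V⟨ F ⟩ → v ∈ V⟨ F ⟩ → Walk F u v

  Acyclic : Subset #E → Set
  Acyclic F = ∀ {v} (w : Walk F v v) → ¬ IsCycle w

  IsRootedTree : Subset #E → Vertex → Set
  IsRootedTree T r = Empty T ⊎ (Connected T × Acyclic T × r ∈ V⟨ T ⟩)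

  treeVertices : Subset #E → Vertex → Subset #V
  treeVertices T r = V⟨ T ⟩ ∪ ⁅ r ⁆

  IsPartition : ∀ {t} → (Fin t → Subset #E) → Set
  IsPartition T = (∀ i j → i ≢ j → Empty (T i ∩ T j)) × (∀ e → ∃[ i ] e ∈ T i)

  -- A multiset of t vertices is a family Fin t → Vertex, and its sub-multisets
  -- are subsets of the index set Fin t.
  module _ {t : ℕ} (R : Fin t → Vertex) where

    rootsAt : Vertex → Subset t
    rootsAt v = subsetOf (λ i → R i ≟ v)

    rootsIn : Subset #E → Subset t
    rootsIn F = subsetOf (λ i → R i ∈? V⟨ F ⟩)

    HasBasicRootedTreeDecomposition : Matroid t → Set
    HasBasicRootedTreeDecomposition M =
      Σ[ T ∈ (Fin t → Subset #E) ]
        IsPartition T ×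
        (∀ i → IsRootedTree (T i) (R i)) ×
        (∀ v → Matroid.IsBase M (subsetOf (λ i → v ∈? treeVertices (T i) (R i))))

{-# OPTIONS --safe #-}

-- Sufficiency adapts the inductive proof of Durand de Gevigney, Nguyen and
-- Szigeti on matroid-based packings of arborescences to undirected graphs.  The
-- trees are grown edge by edge.  With A the set of unused edges and S v the set
-- of indices whose tree already reaches v, one maintains that S v is
-- independent and that
--     ∣ E[ X ] ∩ A ∣ + ∑ (v ∈ X) ∣ S v ∣ + k ≤ k ∣ X ∣ + rank (⋃ (v ∈ X) S v)
-- for all non-empty X.  Giving an edge uw of A to the tree of some s ∈ S u not
-- spanned by S w preserves this unless some Y with w ∈ Y and u ∉ Y attains
-- equality and spans s.  Uncrossing such a Y with a set X that attains equality
-- and contains u, w yields equality for the smaller set X ∩ Y, in which w still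
-- does not span everything, so the search for a usable edge terminates.
--
-- Necessity is double counting: a tree with vertex set U contains fewer than
-- ∣ X ∩ U ∣ edges inside X once X ∩ U is non-empty, and each vertex lies on k
-- trees.

module Submission where

open import Defs
open import Data.Nat.Base
open import Data.Nat.Properties hiding (_≟_)
open import Data.Nat.Tactic.RingSolver using (solve-∀)
import Data.Integer.Base as ℤ
import Data.Integer.Properties as ℤ
import Data.Integer.Tactic.RingSolver as ℤ-Ring
open import Data.Bool.Base using (_∧_; _∨_)
open import Data.Fin.Base using (Fin; zero; suc)
open import Data.Fin.Properties using (_≟_; any?) renaming (suc-injective to Fin-suc-injective)
open import Data.Fin.Subset hiding (⋃)
open import Data.Fin.Subset.Properties
open import Data.List.Base using (List; []; _∷_; _++_; [_]; filter; upTo)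
open import Data.List.Extrema ≤-totalOrder using (argmax-sel)
open import Data.List.Extrema.Nat using (xs≤max)
open import Data.List.Membership.Propositional.Properties using (∈-filter⁺; ∈-filter⁻; ∈-upTo⁺)
open import Data.List.Relation.Unary.All as All using (All; []; _∷_)
import Data.List.Relation.Unary.All.Properties as All
open import Data.List.Relation.Unary.AllPairs using ([]; _∷_)
import Data.List.Relation.Unary.AllPairs.Properties as AllPairs
open import Data.List.Relation.Unary.Unique.Propositional using (Unique)
open import Data.Product.Base
open import Data.Sum.Base using (_⊎_; inj₁; inj₂; [_,_]′)
open import Data.Vec.Base using ([]; _∷_; lookup)
open import Data.Vec.Functional using (updateAt)
open import Data.Vec.Functional.Properties using (updateAt-updates; updateAt-minimal)
open import Data.Vec.Properties using ([]=⇒lookup; lookup⇒[]=; lookup∘tabulate; lookup-zipWith)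
open import Algebra.Properties.Semiring.Sum +-*-semiring
  using (sum; sum-cong-≗; ∑-distrib-+; ∑-comm; *-distribˡ-sum)
open import Function.Base using (id; _∘_)
open import Function.Bundles using (_⇔_; mk⇔)
open import Relation.Binary.PropositionalEquality hiding ([_])
open import Relation.Nullary
open import Relation.Nullary.Decidable using (dec-true)
open import Relation.Unary using (Decidable)

-- Subsets of finite sets, indicator functions and sums.

∈-subsetOf⁺ : ∀ {n} {P : Fin n → Set} (P? : Decidable P) {x} → P x → x ∈ subsetOf P?
∈-subsetOf⁺ P? {x} px =
  lookup⇒[]= x _ (trans (lookup∘tabulate _ x) (dec-true (P? x) px))

∈-subsetOf⁻ : ∀ {n} {P : Fin n → Set} (P? : Decidable P) {x} → x ∈ subsetOf P? → P x
∈-subsetOf⁻ P? {x} x∈ with P? x | trans (sym (lookup∘tabulate _ x)) ([]=⇒lookup x∈)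
... | yes px | _ = px

𝟙 : Side → ℕ
𝟙 inside  = 1
𝟙 outside = 0

χ : ∀ {n} → Subset n → Fin n → ℕ
χ p x = 𝟙 (lookup p x)

χ-∈ : ∀ {n} {p : Subset n} {x} → x ∈ p → χ p x ≡ 1
χ-∈ x∈p = cong 𝟙 ([]=⇒lookup x∈p)

χ-∉ : ∀ {n} {p : Subset n} {x} → x ∉ p → χ p x ≡ 0
χ-∉ {p = p} {x} x∉p with lookup p x in eq
... | inside  = contradiction (lookup⇒[]= x p eq) x∉p
... | outside = refl

χ-cong : ∀ {m n} {p : Subset m} {q : Subset n} {x y} →
         (x ∈ p → y ∈ q) → (y ∈ q → x ∈ p) → χ p x ≡ χ q y
χ-cong {p = p} {x = x} f g with x ∈? p
... | yes x∈p = trans (χ-∈ x∈p) (sym (χ-∈ (f x∈p)))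
... | no  x∉p = trans (χ-∉ x∉p) (sym (χ-∉ (x∉p ∘ g)))

χ-mono : ∀ {n} {p q : Subset n} → p ⊆ q → ∀ x → χ p x ≤ χ q x
χ-mono {p = p} p⊆q x with x ∈? p
... | yes x∈p = ≤-reflexive (trans (χ-∈ x∈p) (sym (χ-∈ (p⊆q x∈p))))
... | no  x∉p = ≤-trans (≤-reflexive (χ-∉ x∉p)) z≤n

χ-∩∪ : ∀ {n} (p q : Subset n) x → χ (p ∩ q) x + χ (p ∪ q) x ≡ χ p x + χ q x
χ-∩∪ p q x rewrite lookup-zipWith _∧_ x p q | lookup-zipWith _∨_ x p q
  with lookup p x | lookup q x
... | inside  | inside  = refl
... | inside  | outside = refl
... | outside | inside  = refl
... | outside | outside = refl

sum-mono-≤ : ∀ {n} {f g : Fin n → ℕ} → (∀ i → f i ≤ g i) → sum f ≤ sum g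
sum-mono-≤ {zero}  f≤g = z≤n
sum-mono-≤ {suc n} f≤g = +-mono-≤ (f≤g zero) (sum-mono-≤ (f≤g ∘ suc))

sum-mono-< : ∀ {n} {f g : Fin n → ℕ} → (∀ i → f i ≤ g i) → ∀ i → f i < g i → sum f < sum g
sum-mono-< f≤g zero    fi<gi = +-mono-<-≤ fi<gi (sum-mono-≤ (f≤g ∘ suc))
sum-mono-< f≤g (suc i) fi<gi = +-mono-≤-< (f≤g zero) (sum-mono-< (f≤g ∘ suc) i fi<gi)

sum-const : ∀ n c → sum {n} (λ _ → c) ≡ c * n
sum-const zero    c = sym (*-zeroʳ c)
sum-const (suc n) c = trans (cong (c +_) (sum-const n c)) (sym (*-suc c n))

sum-update : ∀ {n} {f g : Fin n → ℕ} i c → (∀ j → j ≢ i → f j ≡ g j) → g i ≡ f i + c →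
             sum g ≡ sum f + c
sum-update {suc n} {f} {g} zero c f≗g gi =
  trans (cong₂ _+_ gi (sum-cong-≗ (λ j → sym (f≗g (suc j) λ ()))))
        (lemma (f zero) c (sum (f ∘ suc)))
  where
  lemma : ∀ a b d → a + b + d ≡ a + d + b
  lemma = solve-∀
sum-update {suc n} {f} (suc i) c f≗g gi =
  trans (cong₂ _+_ (sym (f≗g zero λ ()))
                   (sum-update i c (λ j j≢i → f≗g (suc j) (j≢i ∘ Fin-suc-injective)) gi))
        (sym (+-assoc (f zero) _ c))

∣∣≡∑χ : ∀ {n} (p : Subset n) → ∣ p ∣ ≡ sum (χ p)
∣∣≡∑χ []            = refl
∣∣≡∑χ (inside  ∷ p) = cong suc (∣∣≡∑χ p)
∣∣≡∑χ (outside ∷ p) = ∣∣≡∑χ p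

∣p∩q∣+∣p∪q∣ : ∀ {n} (p q : Subset n) → ∣ p ∩ q ∣ + ∣ p ∪ q ∣ ≡ ∣ p ∣ + ∣ q ∣
∣p∩q∣+∣p∪q∣ p q
  rewrite ∣∣≡∑χ (p ∩ q) | ∣∣≡∑χ (p ∪ q) | ∣∣≡∑χ p | ∣∣≡∑χ q =
  trans (sym (∑-distrib-+ (χ (p ∩ q)) (χ (p ∪ q))))
        (trans (sum-cong-≗ (χ-∩∪ p q)) (∑-distrib-+ (χ p) (χ q)))

∣p∪q∣≤∣p∣+∣q∣ : ∀ {n} (p q : Subset n) → ∣ p ∪ q ∣ ≤ ∣ p ∣ + ∣ q ∣
∣p∪q∣≤∣p∣+∣q∣ p q = ≤-trans (m≤n+m _ ∣ p ∩ q ∣) (≤-reflexive (∣p∩q∣+∣p∪q∣ p q))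

disjoint⇒∣p∪q∣ : ∀ {n} (p q : Subset n) → Empty (p ∩ q) → ∣ p ∪ q ∣ ≡ ∣ p ∣ + ∣ q ∣
disjoint⇒∣p∪q∣ {n} p q e = trans (cong (_+ ∣ p ∪ q ∣) (sym ∣p∩q∣≡0)) (∣p∩q∣+∣p∪q∣ p q)
  where
  ∣p∩q∣≡0 : ∣ p ∩ q ∣ ≡ 0
  ∣p∩q∣≡0 = trans (cong ∣_∣ (Empty-unique e)) (∣⊥∣≡0 n)

x∈∪⁅y⁆⁻ : ∀ {n} {p : Subset n} {x y} → x ∈ p ∪ ⁅ y ⁆ → x ∈ p ⊎ x ≡ y
x∈∪⁅y⁆⁻ {p = p} {y = y} x∈ with x∈p∪q⁻ p ⁅ y ⁆ x∈
... | inj₁ x∈p = inj₁ x∈p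
... | inj₂ x∈y = inj₂ (x∈⁅y⁆⇒x≡y y x∈y)

∪-lub : ∀ {n} {p q r : Subset n} → p ⊆ r → q ⊆ r → p ∪ q ⊆ r
∪-lub {p = p} {q} p⊆r q⊆r = [ p⊆r , q⊆r ]′ ∘ x∈p∪q⁻ p q

∪-mono : ∀ {n} {p q p′ q′ : Subset n} → p ⊆ p′ → q ⊆ q′ → p ∪ q ⊆ p′ ∪ q′
∪-mono {p′ = p′} {q′} f g = ∪-lub (p⊆p∪q q′ ∘ f) (q⊆p∪q p′ q′ ∘ g)

⁅x⁆⊆ : ∀ {n} {p : Subset n} {x} → x ∈ p → ⁅ x ⁆ ⊆ p
⁅x⁆⊆ {p = p} {x} x∈p y∈ = subst (_∈ p) (sym (x∈⁅y⁆⇒x≡y x y∈)) x∈p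

x∈p∪⁅x⁆ : ∀ {n} {p : Subset n} {x} → x ∈ p ∪ ⁅ x ⁆
x∈p∪⁅x⁆ {p = p} {x} = q⊆p∪q p ⁅ x ⁆ (x∈⁅x⁆ x)

∣p∪⁅x⁆∣ : ∀ {n} {p : Subset n} {x} → x ∉ p → ∣ p ∪ ⁅ x ⁆ ∣ ≡ suc ∣ p ∣
∣p∪⁅x⁆∣ {p = p} {x} x∉p =
  trans (disjoint⇒∣p∪q∣ p ⁅ x ⁆ e) (trans (cong (∣ p ∣ +_) (∣⁅x⁆∣≡1 x)) (+-comm ∣ p ∣ 1))
  where
  e : Empty (p ∩ ⁅ x ⁆)
  e (y , y∈) with x∈p∩q⁻ p ⁅ x ⁆ y∈
  ... | y∈p , y∈x = x∉p (subst (_∈ p) (x∈⁅y⁆⇒x≡y x y∈x) y∈p)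

∣p∣≡0⇒Empty : ∀ {n} {p : Subset n} → ∣ p ∣ ≡ 0 → Empty p
∣p∣≡0⇒Empty {p = p} eq (x , x∈p) =
  1+n≰n (≤-trans (≤-reflexive (sym (∣⁅x⁆∣≡1 x))) (≤-trans (p⊆q⇒∣p∣≤∣q∣ (⁅x⁆⊆ x∈p)) (≤-reflexive eq)))

-- The rank function of a matroid, spanning and bases.

module MatroidRank {t : ℕ} (M : Matroid t) where
  open Matroid M

  private
    sizes : Subset t → List ℕ
    sizes S = filter (hasIndepOfSize? S) (upTo (suc t))

  indep⇒∣∣≤rank : ∀ {I S} → Indep I → I ⊆ S → ∣ I ∣ ≤ rank S
  indep⇒∣∣≤rank {I} {S} ind I⊆S =
    All.lookup (xs≤max 0 (sizes S))
      (∈-filter⁺ (hasIndepOfSize? S) (∈-upTo⁺ (s≤s (∣p∣≤n I))) (I , I⊆S , ind , refl))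

  rank-attained : ∀ S → ∃[ I ] I ⊆ S × Indep I × ∣ I ∣ ≡ rank S
  -- The maximum is either the default value 0, realised by `⊥`, or one of the listed sizes, which
  -- carries its own witness.
  rank-attained S with argmax-sel id 0 (sizes S)
  ... | inj₁ r≡0 = ⊥ , ⊆-min S , empty , trans (∣⊥∣≡0 t) (sym r≡0)
  ... | inj₂ r∈  = proj₂ (∈-filter⁻ (hasIndepOfSize? S) {xs = upTo (suc t)} r∈)

  rank≤∣∣ : ∀ S → rank S ≤ ∣ S ∣
  rank≤∣∣ S with rank-attained S
  ... | I , I⊆S , _ , eq = ≤-trans (≤-reflexive (sym eq)) (p⊆q⇒∣p∣≤∣q∣ I⊆S)

  rank-indep : ∀ {I} → Indep I → rank I ≡ ∣ I ∣
  rank-indep {I} ind = ≤-antisym (rank≤∣∣ I) (indep⇒∣∣≤rank ind id)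

  rank-mono : ∀ {S S′} → S ⊆ S′ → rank S ≤ rank S′
  rank-mono {S} {S′} S⊆S′ with rank-attained S
  ... | I , I⊆S , ind , eq = ≤-trans (≤-reflexive (sym eq)) (indep⇒∣∣≤rank ind (S⊆S′ ∘ I⊆S))

  extend : ∀ {J S} → J ⊆ S → Indep J → ∃[ I ] J ⊆ I × I ⊆ S × Indep I × ∣ I ∣ ≡ rank S
  -- The fuel is the number of elements still missing. Each round augments from a maximum
  -- independent subset of `S` and uses up one unit.
  extend {J} {S} J⊆S indJ = go (rank S ∸ ∣ J ∣) J id J⊆S indJ
                               (≤-reflexive (sym (m∸n+n≡m (indep⇒∣∣≤rank indJ J⊆S))))
    where
    go : ∀ m I → J ⊆ I → I ⊆ S → Indep I → rank S ≤ m + ∣ I ∣ →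
         ∃[ I ] J ⊆ I × I ⊆ S × Indep I × ∣ I ∣ ≡ rank S
    go zero    I J⊆I I⊆S ind r≤ = I , J⊆I , I⊆S , ind , ≤-antisym (indep⇒∣∣≤rank ind I⊆S) r≤
    go (suc m) I J⊆I I⊆S ind r≤ with ∣ I ∣ <? rank S
    ... | no ∣I∣≮r = I , J⊆I , I⊆S , ind , ≤-antisym (indep⇒∣∣≤rank ind I⊆S) (≮⇒≥ ∣I∣≮r)
    ... | yes ∣I∣<r with rank-attained S
    ...   | K , K⊆S , indK , eq with augment ind indK (≤-trans ∣I∣<r (≤-reflexive (sym eq)))
    ...     | x , x∈K , x∉I , ind′ =
      go m (I ∪ ⁅ x ⁆) (p⊆p∪q ⁅ x ⁆ ∘ J⊆I) (∪-lub I⊆S (⁅x⁆⊆ (K⊆S x∈K))) ind′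
         (≤-trans r≤ (≤-reflexive (trans (sym (+-suc m ∣ I ∣))
                                         (cong (m +_) (sym (∣p∪⁅x⁆∣ x∉I))))))

  -- Extend a maximum independent subset of S ∩ S′ to one of S ∪ S′, and trace
  -- the latter on S and on S′.
  rank-submodular : ∀ S S′ → rank (S ∩ S′) + rank (S ∪ S′) ≤ rank S + rank S′
  rank-submodular S S′ with rank-attained (S ∩ S′)
  ... | J , J⊆ , indJ , eqJ
    with extend (p⊆p∪q S′ ∘ p∩q⊆p S S′ ∘ J⊆) indJ
  ...   | I , J⊆I , I⊆ , indI , eqI = begin
    rank (S ∩ S′) + rank (S ∪ S′)            ≡⟨ cong₂ _+_ eqJ eqI ⟨
    ∣ J ∣ + ∣ I ∣                            ≤⟨ +-mono-≤ (p⊆q⇒∣p∣≤∣q∣ J⊆∩) (p⊆q⇒∣p∣≤∣q∣ I⊆∪) ⟩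
    ∣ I∩S ∩ I∩S′ ∣ + ∣ I∩S ∪ I∩S′ ∣          ≡⟨ ∣p∩q∣+∣p∪q∣ I∩S I∩S′ ⟩
    ∣ I∩S ∣ + ∣ I∩S′ ∣                       ≤⟨ +-mono-≤ (trace S) (trace S′) ⟩
    rank S + rank S′                         ∎
    where
    open ≤-Reasoning
    I∩S I∩S′ : Subset t
    I∩S  = I ∩ S
    I∩S′ = I ∩ S′
    trace : ∀ P → ∣ I ∩ P ∣ ≤ rank P
    trace P = indep⇒∣∣≤rank (closed (p∩q⊆p I P) indI) (p∩q⊆q I P)
    J⊆∩ : J ⊆ I∩S ∩ I∩S′
    J⊆∩ x∈J = x∈p∩q⁺ (x∈p∩q⁺ (J⊆I x∈J , p∩q⊆p S S′ (J⊆ x∈J)) ,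
                      x∈p∩q⁺ (J⊆I x∈J , p∩q⊆q S S′ (J⊆ x∈J)))
    I⊆∪ : I ⊆ I∩S ∪ I∩S′
    I⊆∪ x∈I with x∈p∪q⁻ S S′ (I⊆ x∈I)
    ... | inj₁ x∈S  = x∈p∪q⁺ (inj₁ (x∈p∩q⁺ (x∈I , x∈S)))
    ... | inj₂ x∈S′ = x∈p∪q⁺ (inj₂ (x∈p∩q⁺ (x∈I , x∈S′)))

  infix 4 _Spans_ _spans?_

  -- Says that `P` lies in the closure of `S`. The formulation by ranks makes it decidable and open
  -- to submodularity.
  _Spans_ : Subset t → Subset t → Set
  S Spans P = rank (S ∪ P) ≤ rank S

  _spans?_ : ∀ S P → Dec (S Spans P)
  S spans? P = rank (S ∪ P) ≤? rank S

  spans-refl : ∀ {S} → S Spans S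
  spans-refl = rank-mono (∪-lub id id)

  -- Submodularity for `S ∪ P` and `P ∪ Q`: their intersection contains `P` and their union contains
  -- `S ∪ Q`, so the rank of `P` cancels.
  spans-trans : ∀ {S P Q} → S Spans P → P Spans Q → S Spans Q
  spans-trans {S} {P} {Q} S→P P→Q = +-cancelˡ-≤ (rank P) _ _ (begin
    rank P + rank (S ∪ Q)                              ≤⟨ +-mono-≤ (rank-mono P⊆) (rank-mono SQ⊆) ⟩
    rank ((S ∪ P) ∩ (P ∪ Q)) + rank ((S ∪ P) ∪ (P ∪ Q)) ≤⟨ rank-submodular (S ∪ P) (P ∪ Q) ⟩
    rank (S ∪ P) + rank (P ∪ Q)                        ≤⟨ +-mono-≤ S→P P→Q ⟩
    rank S + rank P                                    ≡⟨ +-comm (rank S) (rank P) ⟩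
    rank P + rank S                                    ∎)
    where
    open ≤-Reasoning
    P⊆ : P ⊆ (S ∪ P) ∩ (P ∪ Q)
    P⊆ x∈P = x∈p∩q⁺ (q⊆p∪q S P x∈P , p⊆p∪q Q x∈P)
    SQ⊆ : S ∪ Q ⊆ (S ∪ P) ∪ (P ∪ Q)
    SQ⊆ = ∪-mono (p⊆p∪q P) (q⊆p∪q P Q)

  -- A maximum independent subset of `I ∪ P` is larger than `I`, and the element by which it
  -- augments `I` can only come from `P`.
  unspanned : ∀ {I P} → Indep I → ¬ (I Spans P) → ∃[ x ] x ∈ P × x ∉ I × Indep (I ∪ ⁅ x ⁆)
  unspanned {I} {P} indI ¬sp with rank-attained (I ∪ P)
  ... | J , J⊆ , indJ , eqJ
    with augment indI indJ (subst₂ _<_ (rank-indep indI) (sym eqJ) (≰⇒> ¬sp))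
  ...   | x , x∈J , x∉I , ind′ with x∈p∪q⁻ I P (J⊆ x∈J)
  ...     | inj₁ x∈I = contradiction x∈I x∉I
  ...     | inj₂ x∈P = x , x∈P , x∉I , ind′

  -- Deleting an element lowers the rank by at most one. For a maximum independent `J` in `S`, the
  -- set `J ∩ P` is independent in `P`, while `J ∪ P` stays inside `S`.
  rank-deficiency : ∀ {P S} → P ⊆ S → rank S + ∣ P ∣ ≤ rank P + ∣ S ∣
  rank-deficiency {P} {S} P⊆S with rank-attained S
  ... | J , J⊆S , indJ , eqJ = begin
    rank S + ∣ P ∣              ≡⟨ cong (_+ ∣ P ∣) eqJ ⟨
    ∣ J ∣ + ∣ P ∣               ≡⟨ ∣p∩q∣+∣p∪q∣ J P ⟨
    ∣ J ∩ P ∣ + ∣ J ∪ P ∣       ≤⟨ +-mono-≤ (indep⇒∣∣≤rank (closed (p∩q⊆p J P) indJ) (p∩q⊆q J P))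
                                            (p⊆q⇒∣p∣≤∣q∣ (∪-lub J⊆S P⊆S)) ⟩
    rank P + ∣ S ∣              ∎
    where open ≤-Reasoning

  -- A base extends to an independent set of full rank size, and by maximality this extension adds
  -- nothing.
  base⇒∣∣≡rank : ∀ {B} → IsBase B → ∣ B ∣ ≡ rank ⊤
  base⇒∣∣≡rank {B} (indB , maximal) with extend (⊆-max B) indB
  ... | I , B⊆I , _ , indI , eq = trans (cong ∣_∣ (⊆-antisym B⊆I (maximal I indI B⊆I))) eq

  indep∧rank≤∣∣⇒base : ∀ {B} → Indep B → rank ⊤ ≤ ∣ B ∣ → IsBase B
  indep∧rank≤∣∣⇒base {B} indB r≤ = indB , maximal
    where
    maximal : ∀ I → Indep I → B ⊆ I → I ⊆ B
    maximal I indI B⊆I {x} x∈I with x ∈? B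
    ... | yes x∈B = x∈B
    ... | no  x∉B = contradiction (≤-trans (p⊂q⇒∣p∣<∣q∣ (B⊆I , x , x∈I , x∉B))
                                           (≤-trans (indep⇒∣∣≤rank indI (⊆-max I)) r≤))
                                  1+n≰n

-- One-element extensions of sets and lists.

∩-∪⁅⁆-⊇ : ∀ {n} (p q : Subset n) x → p ∩ q ⊆ p ∩ (q ∪ ⁅ x ⁆)
∩-∪⁅⁆-⊇ p q x y∈ = x∈p∩q⁺ (p∩q⊆p p q y∈ , p⊆p∪q ⁅ x ⁆ (p∩q⊆q p q y∈))

∩-∪⁅⁆-∉ : ∀ {n} {p q : Subset n} {x} → x ∉ p → p ∩ (q ∪ ⁅ x ⁆) ≡ p ∩ q
∩-∪⁅⁆-∉ {p = p} {q} {x} x∉p = ⊆-antisym ⊆₁ (∩-∪⁅⁆-⊇ p q x)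
  where
  ⊆₁ : p ∩ (q ∪ ⁅ x ⁆) ⊆ p ∩ q
  ⊆₁ y∈ with x∈p∩q⁻ p (q ∪ ⁅ x ⁆) y∈
  ... | y∈p , y∈q∪x with x∈∪⁅y⁆⁻ y∈q∪x
  ...   | inj₁ y∈q  = x∈p∩q⁺ (y∈p , y∈q)
  ...   | inj₂ refl = contradiction y∈p x∉p

∩-∪⁅⁆-∈ : ∀ {n} {p q : Subset n} {x} → x ∈ p → p ∩ (q ∪ ⁅ x ⁆) ≡ (p ∩ q) ∪ ⁅ x ⁆
∩-∪⁅⁆-∈ {p = p} {q} {x} x∈p =
  ⊆-antisym ⊆₁ (∪-lub (∩-∪⁅⁆-⊇ p q x) (⁅x⁆⊆ (x∈p∩q⁺ (x∈p , x∈p∪⁅x⁆))))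
  where
  ⊆₁ : p ∩ (q ∪ ⁅ x ⁆) ⊆ (p ∩ q) ∪ ⁅ x ⁆
  ⊆₁ y∈ with x∈p∩q⁻ p (q ∪ ⁅ x ⁆) y∈
  ... | y∈p , y∈q∪x with x∈∪⁅y⁆⁻ y∈q∪x
  ...   | inj₁ y∈q  = p⊆p∪q ⁅ x ⁆ (x∈p∩q⁺ (y∈p , y∈q))
  ...   | inj₂ refl = x∈p∪⁅x⁆

Unique-∷ʳ : ∀ {A : Set} {xs : List A} {x} → Unique xs → All (_≢ x) xs → Unique (xs ++ [ x ])
Unique-∷ʳ u ≢x = AllPairs.++⁺ u ([] ∷ []) (All.map (_∷ []) ≢x)

-- Incidence, walks and paths.

module GraphLemmas (G : Graph) where
  open Graph G

  src tgt : Edge → Vertex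
  src e = proj₁ (ends e)
  tgt e = proj₂ (ends e)

  ∈V⁺ : ∀ {F v e} → e ∈ F → Incident v e → v ∈ V⟨ F ⟩
  ∈V⁺ {e = e} e∈F inc = ∈-subsetOf⁺ (λ v → any? (λ e → (e ∈? _) ×-dec incident? v e)) (e , e∈F , inc)

  ∈V⁻ : ∀ {F v} → v ∈ V⟨ F ⟩ → ∃[ e ] e ∈ F × Incident v e
  ∈V⁻ = ∈-subsetOf⁻ (λ v → any? (λ e → (e ∈? _) ×-dec incident? v e))

  V-lub : ∀ {F X} → (∀ {e} → e ∈ F → src e ∈ X × tgt e ∈ X) → V⟨ F ⟩ ⊆ X
  V-lub F⊆ v∈ with ∈V⁻ v∈
  ... | e , e∈F , inj₁ refl = proj₁ (F⊆ e∈F)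
  ... | e , e∈F , inj₂ refl = proj₂ (F⊆ e∈F)

  V-mono : ∀ {F F′} → F ⊆ F′ → V⟨ F ⟩ ⊆ V⟨ F′ ⟩
  V-mono F⊆F′ = V-lub λ e∈F → ∈V⁺ (F⊆F′ e∈F) (inj₁ refl) , ∈V⁺ (F⊆F′ e∈F) (inj₂ refl)

  joins-sym : ∀ {e u v} → Joins e u v → Joins e v u
  joins-sym (inj₁ eq) = inj₂ eq
  joins-sym (inj₂ eq) = inj₁ eq

  joins⇒incident : ∀ {e u v} → Joins e u v → Incident u e × Incident v e
  joins⇒incident (inj₁ eq) = inj₁ (sym (cong proj₁ eq)) , inj₂ (sym (cong proj₂ eq))
  joins⇒incident (inj₂ eq) = inj₂ (sym (cong proj₂ eq)) , inj₁ (sym (cong proj₁ eq))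

  joins-∈ : ∀ {e u v X} → Joins e u v → u ∈ X → v ∈ X → src e ∈ X × tgt e ∈ X
  joins-∈ {X = X} (inj₁ eq) u∈ v∈ =
    subst (_∈ X) (sym (cong proj₁ eq)) u∈ , subst (_∈ X) (sym (cong proj₂ eq)) v∈
  joins-∈ {X = X} (inj₂ eq) u∈ v∈ =
    subst (_∈ X) (sym (cong proj₁ eq)) v∈ , subst (_∈ X) (sym (cong proj₂ eq)) u∈

  ∈-joins : ∀ {e u v X} → Joins e u v → src e ∈ X × tgt e ∈ X → u ∈ X × v ∈ X
  ∈-joins {X = X} (inj₁ eq) (s∈ , t∈) = subst (_∈ X) (cong proj₁ eq) s∈ , subst (_∈ X) (cong proj₂ eq) t∈
  ∈-joins {X = X} (inj₂ eq) (s∈ , t∈) = subst (_∈ X) (cong proj₂ eq) t∈ , subst (_∈ X) (cong proj₁ eq) s∈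

  joins-unique : ∀ {e u v a b} → Joins e u v → Joins e a b → (a ≡ u × b ≡ v) ⊎ (a ≡ v × b ≡ u)
  joins-unique (inj₁ p) (inj₁ q) with refl ← trans (sym p) q = inj₁ (refl , refl)
  joins-unique (inj₁ p) (inj₂ q) with refl ← trans (sym p) q = inj₂ (refl , refl)
  joins-unique (inj₂ p) (inj₁ q) with refl ← trans (sym p) q = inj₂ (refl , refl)
  joins-unique (inj₂ p) (inj₂ q) with refl ← trans (sym p) q = inj₁ (refl , refl)

  mapWalk : ∀ {F F′} → F ⊆ F′ → ∀ {a b} → Walk F a b → Walk F′ a b
  mapWalk F⊆ stop            = stop
  mapWalk F⊆ (step e e∈ j w) = step e (F⊆ e∈) j (mapWalk F⊆ w)

  edges-mapWalk : ∀ {F F′} (F⊆ : F ⊆ F′) {a b} (w : Walk F a b) → edges (mapWalk F⊆ w) ≡ edges w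
  edges-mapWalk F⊆ stop            = refl
  edges-mapWalk F⊆ (step e e∈ j w) = cong (e ∷_) (edges-mapWalk F⊆ w)

  startVertices-mapWalk : ∀ {F F′} (F⊆ : F ⊆ F′) {a b} (w : Walk F a b) →
                          startVertices (mapWalk F⊆ w) ≡ startVertices w
  startVertices-mapWalk F⊆ stop                    = refl
  startVertices-mapWalk F⊆ (step {u = u} e e∈ j w) = cong (u ∷_) (startVertices-mapWalk F⊆ w)

  snoc : ∀ {F a b c} → Walk F a b → ∀ e → e ∈ F → Joins e b c → Walk F a c
  snoc stop             e e∈ j = step e e∈ j stop
  snoc (step f f∈ j′ w) e e∈ j = step f f∈ j′ (snoc w e e∈ j)

  edges-snoc : ∀ {F a b c} (w : Walk F a b) e (e∈ : e ∈ F) (j : Joins e b c) →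
               edges (snoc w e e∈ j) ≡ edges w ++ [ e ]
  edges-snoc stop             e e∈ j = refl
  edges-snoc (step f f∈ j′ w) e e∈ j = cong (f ∷_) (edges-snoc w e e∈ j)

  startVertices-snoc : ∀ {F a b c} (w : Walk F a b) e (e∈ : e ∈ F) (j : Joins e b c) →
                       startVertices (snoc w e e∈ j) ≡ startVertices w ++ [ b ]
  startVertices-snoc stop                     e e∈ j = refl
  startVertices-snoc (step {u = u} f f∈ j′ w) e e∈ j = cong (u ∷_) (startVertices-snoc w e e∈ j)

  edges⊆ : ∀ {F a b} (w : Walk F a b) → All (_∈ F) (edges w)
  edges⊆ stop            = []
  edges⊆ (step e e∈ j w) = e∈ ∷ edges⊆ w

  startVertices⊆V : ∀ {F a b} (w : Walk F a b) → All (_∈ V⟨ F ⟩) (startVertices w)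
  startVertices⊆V stop            = []
  startVertices⊆V (step e e∈ j w) = ∈V⁺ e∈ (proj₁ (joins⇒incident j)) ∷ startVertices⊆V w

  -- The last vertex is absent from `startVertices`, so its distinctness from the others is a
  -- separate clause. With it, adding an edge back from `b` to `a` gives distinct start vertices, as
  -- a cycle requires.
  IsPath : ∀ {F a b} → Walk F a b → Set
  IsPath {b = b} w = Unique (edges w) × Unique (startVertices w) × All (_≢ b) (startVertices w)

  mapWalk-path : ∀ {F F′} (F⊆ : F ⊆ F′) {a b} {w : Walk F a b} → IsPath w → IsPath (mapWalk F⊆ w)
  mapWalk-path F⊆ {w = w} (ue , uv , ≢b)
    rewrite edges-mapWalk F⊆ w | startVertices-mapWalk F⊆ w = ue , uv , ≢b

  cons-path : ∀ {F a b c e} (w : Walk F b c) (e∈ : e ∈ F) (j : Joins e a b) → IsPath w →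
              All (e ≢_) (edges w) → All (a ≢_) (startVertices w) → a ≢ c → IsPath (step e e∈ j w)
  cons-path w e∈ j (ue , uv , ≢c) e≢ a≢ a≢c = e≢ ∷ ue , a≢ ∷ uv , a≢c ∷ ≢c

  snoc-path : ∀ {F a b c e} (w : Walk F a b) (e∈ : e ∈ F) (j : Joins e b c) → IsPath w →
              All (e ≢_) (edges w) → All (c ≢_) (startVertices w) → c ≢ b → IsPath (snoc w e e∈ j)
  snoc-path {e = e} w e∈ j (ue , uv , ≢b) e≢ c≢ c≢b
    rewrite edges-snoc w e e∈ j | startVertices-snoc w e e∈ j =
    Unique-∷ʳ ue (All.map ≢-sym e≢) , Unique-∷ʳ uv ≢b , All.++⁺ (All.map ≢-sym c≢) (≢-sym c≢b ∷ [])

-- Rooted trees and their construction by attaching leaves.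

module RootedTrees (G : Graph) where
  open Graph G
  open GraphLemmas G

  -- A rooted tree together with the order in which it is grown from its root by
  -- attaching leaves.
  data Grown (r : Vertex) : Subset #E → Subset #V → Set where
    root : Grown r ⊥ ⁅ r ⁆
    grow : ∀ {T U e u v} → Grown r T U → Joins e u v → u ∈ U → v ∉ U →
           Grown r (T ∪ ⁅ e ⁆) (U ∪ ⁅ v ⁆)

  root∈ : ∀ {r T U} → Grown r T U → r ∈ U
  root∈ root                   = x∈⁅x⁆ _
  root∈ (grow {v = v} g _ _ _) = p⊆p∪q ⁅ v ⁆ (root∈ g)

  ends∈ : ∀ {r T U} → Grown r T U → ∀ {e} → e ∈ T → src e ∈ U × tgt e ∈ U
  ends∈ root e∈ = contradiction e∈ ∉⊥
  ends∈ (grow {v = v} g j u∈ v∉) e∈ with x∈∪⁅y⁆⁻ e∈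
  ... | inj₁ e∈T  = map (p⊆p∪q ⁅ v ⁆) (p⊆p∪q ⁅ v ⁆) (ends∈ g e∈T)
  ... | inj₂ refl = joins-∈ j (p⊆p∪q ⁅ v ⁆ u∈) x∈p∪⁅x⁆

  V⊆ : ∀ {r T U} → Grown r T U → V⟨ T ⟩ ⊆ U
  V⊆ g = V-lub (ends∈ g)

  leaf-edge∉ : ∀ {r T U} → Grown r T U → ∀ {e u v} → Joins e u v → v ∉ U → e ∉ T
  leaf-edge∉ g j v∉ e∈T = v∉ (proj₂ (∈-joins j (ends∈ g e∈T)))

  ⊆treeVertices : ∀ {r T U} → Grown r T U → U ⊆ treeVertices T r
  ⊆treeVertices {r} root = q⊆p∪q V⟨ ⊥ ⟩ ⁅ r ⁆
  ⊆treeVertices {r} (grow {e = e} g j u∈ v∉) x∈ with x∈∪⁅y⁆⁻ x∈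
  ... | inj₁ x∈U  = ∪-mono (V-mono (p⊆p∪q ⁅ e ⁆)) id (⊆treeVertices g x∈U)
  ... | inj₂ refl = p⊆p∪q ⁅ r ⁆ (∈V⁺ x∈p∪⁅x⁆ (proj₂ (joins⇒incident j)))

  grown⇒treeVertices : ∀ {r T U} → Grown r T U → U ≡ treeVertices T r
  grown⇒treeVertices g = ⊆-antisym (⊆treeVertices g) (∪-lub (V⊆ g) (⁅x⁆⊆ (root∈ g)))

  ∣grown∣ : ∀ {r T U} → Grown r T U → ∣ U ∣ ≡ suc ∣ T ∣
  ∣grown∣ {r} root = trans (∣⁅x⁆∣≡1 r) (cong suc (sym (∣⊥∣≡0 #E)))
  ∣grown∣ (grow g j u∈ v∉) =
    trans (∣p∪⁅x⁆∣ v∉) (cong suc (trans (∣grown∣ g) (sym (∣p∪⁅x⁆∣ (leaf-edge∉ g j v∉)))))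

  -- Induction on the growth. An attached edge in `F` has its new vertex in `X`, so both counts rise
  -- by one; an edge outside `F` leaves the left count alone. The first alternative is there for
  -- trees that may miss `X` altogether.
  forest-bound : ∀ {r T U} → Grown r T U → ∀ {F X} → (∀ {e} → e ∈ F → src e ∈ X × tgt e ∈ X) →
                 ∣ F ∩ T ∣ ≡ 0 ⊎ ∣ F ∩ T ∣ < ∣ X ∩ U ∣
  forest-bound root {F} F⊆ =
    inj₁ (trans (cong ∣_∣ (Empty-unique λ (x , x∈) → ∉⊥ (p∩q⊆q F ⊥ x∈))) (∣⊥∣≡0 #E))
  forest-bound (grow {T} {U} {e} {u} {v} g j u∈ v∉) {F} {X} F⊆ with e ∈? F | forest-bound g F⊆
  ... | no e∉F | inj₁ eq = inj₁ (trans (cong ∣_∣ (∩-∪⁅⁆-∉ e∉F)) eq)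
  ... | no e∉F | inj₂ lt =
    inj₂ (≤-trans (≤-reflexive (cong (suc ∘ ∣_∣) (∩-∪⁅⁆-∉ {q = T} e∉F)))
                  (≤-trans lt (p⊆q⇒∣p∣≤∣q∣ (∩-∪⁅⁆-⊇ X U v))))
  ... | yes e∈F | ih =
    inj₂ (≤-trans (s≤s (≤-reflexive eqF)) (≤-trans (s≤s ih′) (≤-reflexive (sym eqX))))
    where
    uv∈X : u ∈ X × v ∈ X
    uv∈X = ∈-joins j (F⊆ e∈F)
    eqF : ∣ F ∩ (T ∪ ⁅ e ⁆) ∣ ≡ suc ∣ F ∩ T ∣
    eqF = trans (cong ∣_∣ (∩-∪⁅⁆-∈ e∈F)) (∣p∪⁅x⁆∣ (leaf-edge∉ g j v∉ ∘ p∩q⊆q F T))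
    eqX : ∣ X ∩ (U ∪ ⁅ v ⁆) ∣ ≡ suc ∣ X ∩ U ∣
    eqX = trans (cong ∣_∣ (∩-∪⁅⁆-∈ (proj₂ uv∈X))) (∣p∪⁅x⁆∣ (v∉ ∘ p∩q⊆q X U))
    -- If no earlier edge lies in `F`, the old end `u` in `X ∩ U` makes the inequality strict.
    ih′ : ∣ F ∩ T ∣ < ∣ X ∩ U ∣
    ih′ = [ (λ eq → ≤-trans (s≤s (≤-reflexive eq))
                      (n≢0⇒n>0 λ eq′ → ∣p∣≡0⇒Empty eq′ (u , x∈p∩q⁺ (proj₁ uv∈X , u∈))))
          , id ]′ ih

  -- The path in the older tree meets neither the new edge nor the new vertex, so putting the new
  -- edge at its beginning or end creates no repetition.
  grown-path : ∀ {r T U} → Grown r T U → ∀ {a b} → a ∈ U → b ∈ U → Σ (Walk T a b) IsPath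
  grown-path {r} root a∈ b∈
    with refl ← x∈⁅y⁆⇒x≡y r a∈ | refl ← x∈⁅y⁆⇒x≡y r b∈ = stop , [] , [] , []
  grown-path (grow {T} {U} {e} {u} {v} g j u∈ v∉) {a} {b} a∈ b∈ = path (x∈∪⁅y⁆⁻ a∈) (x∈∪⁅y⁆⁻ b∈)
    where
    T⊆ : T ⊆ T ∪ ⁅ e ⁆
    T⊆ = p⊆p∪q ⁅ e ⁆
    e≢ : ∀ {x y} (w : Walk T x y) → All (e ≢_) (edges (mapWalk T⊆ w))
    e≢ w = subst (All (e ≢_)) (sym (edges-mapWalk T⊆ w))
             (All.map (λ f∈T e≡f → leaf-edge∉ g j v∉ (subst (_∈ T) (sym e≡f) f∈T)) (edges⊆ w))
    ∈U⇒v≢ : ∀ {x} → x ∈ U → v ≢ x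
    ∈U⇒v≢ x∈U v≡x = v∉ (subst (_∈ U) (sym v≡x) x∈U)
    v≢ : ∀ {x y} (w : Walk T x y) → All (v ≢_) (startVertices (mapWalk T⊆ w))
    v≢ w = subst (All (v ≢_)) (sym (startVertices-mapWalk T⊆ w))
             (All.map (∈U⇒v≢ ∘ V⊆ g) (startVertices⊆V w))
    path : a ∈ U ⊎ a ≡ v → b ∈ U ⊎ b ≡ v → Σ (Walk (T ∪ ⁅ e ⁆) a b) IsPath
    path (inj₂ refl) (inj₂ refl) = stop , [] , [] , []
    path (inj₁ a∈U)  (inj₁ b∈U)  with grown-path g a∈U b∈U
    ... | w , p = mapWalk T⊆ w , mapWalk-path T⊆ p
    path (inj₂ refl) (inj₁ b∈U)  with grown-path g u∈ b∈U
    ... | w , p = step e x∈p∪⁅x⁆ (joins-sym j) (mapWalk T⊆ w) ,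
      cons-path (mapWalk T⊆ w) x∈p∪⁅x⁆ (joins-sym j) (mapWalk-path T⊆ p) (e≢ w) (v≢ w) (∈U⇒v≢ b∈U)
    path (inj₁ a∈U)  (inj₂ refl) with grown-path g a∈U u∈
    ... | w , p = snoc (mapWalk T⊆ w) e x∈p∪⁅x⁆ j ,
      snoc-path (mapWalk T⊆ w) x∈p∪⁅x⁆ j (mapWalk-path T⊆ p) (e≢ w) (v≢ w) (∈U⇒v≢ u∈)

  -- The lists are kept unchanged so that the defining properties of a cycle carry over to the
  -- smaller tree.
  restrict : ∀ {T e a b} (w : Walk (T ∪ ⁅ e ⁆) a b) → All (e ≢_) (edges w) →
             Σ[ w′ ∈ Walk T a b ] edges w′ ≡ edges w × startVertices w′ ≡ startVertices w
  restrict stop [] = stop , refl , refl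
  restrict (step {u = u} f f∈ j w) (e≢f ∷ e≢) with x∈∪⁅y⁆⁻ f∈ | restrict w e≢
  ... | inj₂ f≡e | _              = contradiction (sym f≡e) e≢f
  ... | inj₁ f∈T | w′ , eqE , eqV = step f f∈T j w′ , cong (f ∷_) eqE , cong (u ∷_) eqV

  module _ {T e u v} (j : Joins e u v) (u≢v : u ≢ v) (v∉V : v ∉ V⟨ T ⟩) where

    walk-from-isolated : ∀ {b} → Walk T v b → v ≡ b
    walk-from-isolated stop             = refl
    walk-from-isolated (step f f∈ j′ w) = contradiction (∈V⁺ f∈ (proj₁ (joins⇒incident j′))) v∉V

    walk-to-isolated : ∀ {a} → Walk T a v → a ≡ v
    walk-to-isolated stop = refl
    walk-to-isolated (step f f∈ j′ w) with refl ← walk-to-isolated w =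
      contradiction (∈V⁺ f∈ (proj₂ (joins⇒incident j′))) v∉V

    -- As `v` is isolated in `T`, the only edge at `v` is `e`. A walk that enters `v` through `e`
    -- would have to repeat `e` to leave again, so it would end at `v`.
    avoids-leaf-edge : ∀ {a b} (w : Walk (T ∪ ⁅ e ⁆) a b) → Unique (edges w) → a ≢ v → b ≢ v →
                       All (e ≢_) (edges w)
    avoids-leaf-edge stop ue a≢v b≢v = []
    avoids-leaf-edge (step {v = x} f f∈ j′ w) (f≢ ∷ ue) a≢v b≢v with x∈∪⁅y⁆⁻ f∈
    ... | inj₁ f∈T = (λ e≡f → v∉V (∈V⁺ (subst (_∈ T) (sym e≡f) f∈T) (proj₂ (joins⇒incident j))))
                   ∷ avoids-leaf-edge w ue
                       (λ x≡v → v∉V (subst (_∈ V⟨ T ⟩) x≡v (∈V⁺ f∈T (proj₂ (joins⇒incident j′))))) b≢v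
    ... | inj₂ refl with joins-unique j j′
    ...   | inj₂ (a≡v , _)    = contradiction a≡v a≢v
    ...   | inj₁ (refl , refl) =
      contradiction (sym (walk-from-isolated (proj₁ (restrict w f≢)))) b≢v

    -- A cycle based away from `v` avoids `e` and lies in `T`. A cycle based at `v` begins with `e`,
    -- and its remainder would be a walk in `T` from `u` to the isolated vertex `v`.
    acyclic-leaf : Acyclic T → Acyclic (T ∪ ⁅ e ⁆)
    acyclic-leaf acyc {a} w (≢[] , ue , uv) with a ≟ v
    ... | no a≢v with restrict w (avoids-leaf-edge w ue a≢v a≢v)
    ...   | w′ , eqE , eqV =
      acyc w′ (≢[] ∘ trans (sym eqE) , subst Unique (sym eqE) ue , subst Unique (sym eqV) uv)
    acyclic-leaf acyc stop (≢[] , _) | yes refl = ≢[] refl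
    acyclic-leaf acyc (step f f∈ j′ w) (_ , f≢ ∷ _ , _) | yes refl with x∈∪⁅y⁆⁻ f∈
    ... | inj₁ f∈T = v∉V (∈V⁺ f∈T (proj₁ (joins⇒incident j′)))
    ... | inj₂ refl with joins-unique j j′
    ...   | inj₁ (v≡u , _)  = u≢v (sym v≡u)
    ...   | inj₂ (_ , refl) = u≢v (walk-to-isolated (proj₁ (restrict w f≢)))

  grown-acyclic : ∀ {r T U} → Grown r T U → Acyclic T
  grown-acyclic root stop (≢[] , _)    = ≢[] refl
  grown-acyclic root (step _ e∈ _ _) _ = ∉⊥ e∈
  grown-acyclic (grow {U = U} g j u∈ v∉) =
    acyclic-leaf j (λ u≡v → v∉ (subst (_∈ U) u≡v u∈)) (v∉ ∘ V⊆ g) (grown-acyclic g)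

  grown⇒rootedTree : ∀ {r T U} → Grown r T U → IsRootedTree T r
  grown⇒rootedTree {r} {T} g with nonempty? T
  ... | no  empty    = inj₁ empty
  ... | yes (e , e∈T) =
    inj₂ ( (λ a∈ b∈ → proj₁ (grown-path g (V⊆ g a∈) (V⊆ g b∈))) , grown-acyclic g
         , r∈V (proj₁ (grown-path g (root∈ g) (V⊆ g src∈))) )
    where
    src∈ : src e ∈ V⟨ T ⟩
    src∈ = ∈V⁺ e∈T (inj₁ refl)
    -- The root is `src e` itself or is incident to the first edge of the walk towards it.
    r∈V : Walk T r (src e) → r ∈ V⟨ T ⟩
    r∈V stop            = src∈
    r∈V (step f f∈ j w) = ∈V⁺ f∈ (proj₁ (joins⇒incident j))

  Closed : Subset #E → Subset #V → Set
  Closed T U = ∀ {e u v} → e ∈ T → Joins e u v → u ∈ U → v ∈ U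

  Leaving : Subset #E → Subset #V → Edge → Set
  Leaving T U e = ∃[ u ] ∃[ v ] e ∈ T × Joins e u v × u ∈ U × v ∉ U

  leaving-or-closed : ∀ T U → ∃ (Leaving T U) ⊎ Closed T U
  leaving-or-closed T U
    with any? (λ e → (e ∈? T) ×-dec (src e ∈? U) ×-dec ¬? (tgt e ∈? U))
       | any? (λ e → (e ∈? T) ×-dec (tgt e ∈? U) ×-dec ¬? (src e ∈? U))
  ... | yes (e , e∈ , s∈ , t∉) | _ = inj₁ (e , src e , tgt e , e∈ , inj₁ refl , s∈ , t∉)
  ... | no _ | yes (e , e∈ , t∈ , s∉) = inj₁ (e , tgt e , src e , e∈ , inj₂ refl , t∈ , s∉)
  ... | no ¬st | no ¬ts = inj₂ closed
    where
    closed : Closed T U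
    closed {e} {u} {v} e∈ j u∈ with v ∈? U
    ... | yes v∈ = v∈
    closed {e} {u} {v} e∈ (inj₁ eq) u∈ | no v∉ =
      contradiction (e , e∈ , subst (_∈ U) (sym (cong proj₁ eq)) u∈ ,
                     v∉ ∘ subst (_∈ U) (cong proj₂ eq)) ¬st
    closed {e} {u} {v} e∈ (inj₂ eq) u∈ | no v∉ =
      contradiction (e , e∈ , subst (_∈ U) (sym (cong proj₂ eq)) u∈ ,
                     v∉ ∘ subst (_∈ U) (cong proj₁ eq)) ¬ts

  grow-maximally : ∀ T r → ∃[ P ] ∃[ U ] P ⊆ T × Grown r P U × Closed T U
  -- Every attached leaf enlarges `U`, which has at most `#V` elements, so this fuel cannot run out
  -- while an edge still leaves `U`.
  grow-maximally T r = go #V root (⊆-min T) (m≤m+n #V _)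
    where
    go : ∀ n {P U} → Grown r P U → P ⊆ T → #V ≤ n + ∣ U ∣ →
         ∃[ P ] ∃[ U ] P ⊆ T × Grown r P U × Closed T U
    go n {P} {U} g P⊆T #V≤ with leaving-or-closed T U
    ... | inj₂ closed = P , U , P⊆T , g , closed
    go (suc n) {P} {U} g P⊆T #V≤ | inj₁ (e , u , v , e∈ , j , u∈ , v∉) =
      go n (grow g j u∈ v∉) (∪-lub P⊆T (⁅x⁆⊆ e∈))
         (≤-trans #V≤ (≤-reflexive (trans (sym (+-suc n ∣ U ∣)) (cong (n +_) (sym (∣p∪⁅x⁆∣ v∉))))))
    go zero {P} {U} g P⊆T #V≤ | inj₁ (e , u , v , e∈ , j , u∈ , v∉) =
      contradiction (≤-trans (s≤s #V≤) (≤-trans (≤-reflexive (sym (∣p∪⁅x⁆∣ v∉))) (∣p∣≤n (U ∪ ⁅ v ⁆)))) 1+n≰n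

  closed-walk∈ : ∀ {T U a b} → Closed T U → Walk T a b → a ∈ U → b ∈ U
  closed-walk∈ closed stop            a∈ = a∈
  closed-walk∈ closed (step e e∈ j w) a∈ = closed-walk∈ closed w (closed e∈ j a∈)

  -- A tree grown maximally inside `T` reaches all of `V⟨ T ⟩` by connectedness. An edge of `T` left
  -- out would close a cycle with the path between its ends in the grown tree.
  rootedTree⇒grown : ∀ {r T} → IsRootedTree T r → Grown r T (treeVertices T r)
  rootedTree⇒grown {r} {T} (inj₁ ∅) = subst (Grown r T) (grown⇒treeVertices g) g
    where
    g : Grown r T ⁅ r ⁆
    g = subst (λ T → Grown r T ⁅ r ⁆) (sym (Empty-unique ∅)) root
  rootedTree⇒grown {r} {T} (inj₂ (conn , acyc , r∈V)) with grow-maximally T r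
  ... | P , U , P⊆T , g , closed = subst (Grown r T) (grown⇒treeVertices g′) g′
    where
    V⊆U : V⟨ T ⟩ ⊆ U
    V⊆U v∈ = closed-walk∈ closed (conn r∈V v∈) (root∈ g)
    T⊆P : T ⊆ P
    T⊆P {e} e∈T with e ∈? P
    ... | yes e∈P = e∈P
    ... | no  e∉P with grown-path g (V⊆U (∈V⁺ e∈T (inj₂ refl))) (V⊆U (∈V⁺ e∈T (inj₁ refl)))
    ...   | w , path with mapWalk-path P⊆T path
    ...     | ue , uv , ≢src = contradiction
      ( (λ ()) , subst (All (e ≢_)) (sym (edges-mapWalk P⊆T w))
                   (All.map (λ f∈P e≡f → e∉P (subst (_∈ P) (sym e≡f) f∈P)) (edges⊆ w)) ∷ ue
      , All.map ≢-sym ≢src ∷ uv )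
      (acyc (step e e∈T (inj₁ refl) (mapWalk P⊆T w)))
    g′ : Grown r T U
    g′ = subst (λ F → Grown r F U) (⊆-antisym P⊆T T⊆P) g

-- Enlarging one member of a family of sets, and relative complements.

attach : ∀ {m n} → (Fin m → Subset n) → Fin m → Fin n → Fin m → Subset n
attach U i x = updateAt U i (_∪ ⁅ x ⁆)

attach-at : ∀ {m n} (U : Fin m → Subset n) i x → attach U i x i ≡ U i ∪ ⁅ x ⁆
attach-at U i x = updateAt-updates i U

attach-other : ∀ {m n} (U : Fin m → Subset n) {i j} x → j ≢ i → attach U i x j ≡ U j
attach-other U {i} {j} x j≢i = updateAt-minimal j i U j≢i

attach-⊇ : ∀ {m n} (U : Fin m → Subset n) i x j → U j ⊆ attach U i x j
attach-⊇ U i x j y∈ with j ≟ i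
... | yes refl = subst (_ ∈_) (sym (attach-at U i x)) (p⊆p∪q ⁅ x ⁆ y∈)
... | no  j≢i  = subst (_ ∈_) (sym (attach-other U x j≢i)) y∈

∈-attach : ∀ {m n} (U : Fin m → Subset n) i x → x ∈ attach U i x i
∈-attach U i x = subst (x ∈_) (sym (attach-at U i x)) x∈p∪⁅x⁆

∈-attach⁻ : ∀ {m n} (U : Fin m → Subset n) {i x j y} → y ∈ attach U i x j → y ∈ U j ⊎ (j ≡ i × y ≡ x)
∈-attach⁻ U {i} {x} {j} y∈ with j ≟ i
... | no  j≢i  = inj₁ (subst (_ ∈_) (attach-other U x j≢i) y∈)
... | yes refl with x∈∪⁅y⁆⁻ (subst (_ ∈_) (attach-at U i x) y∈)
...   | inj₁ y∈U = inj₁ y∈U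
...   | inj₂ y≡x = inj₂ (refl , y≡x)

-- `U` and `S` describe one incidence relation from its two sides. The lemma serves for both
-- inclusions, with the roles of trees and vertices exchanged.
attach-transpose : ∀ {m n} {U : Fin m → Subset n} {S : Fin n → Subset m} {i x} →
                   (∀ {j y} → y ∈ U j → j ∈ S y) →
                   ∀ {j y} → y ∈ attach U i x j → j ∈ attach S x i y
attach-transpose {U = U} {S} {i} {x} U⇒S {j} {y} y∈ with ∈-attach⁻ U y∈
... | inj₁ y∈U           = attach-⊇ S x i y (U⇒S y∈U)
... | inj₂ (refl , refl) = ∈-attach S x i

∩∁-split : ∀ {n} {p q : Subset n} → q ⊆ p → p ⊆ q ∪ (p ∩ ∁ q)
∩∁-split {q = q} q⊆p {x} x∈p with x ∈? q
... | yes x∈q = p⊆p∪q _ x∈q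
... | no  x∉q = q⊆p∪q q _ (x∈p∩q⁺ (x∈p , x∉p⇒x∈∁p x∉q))

∣q∣+∣p∩∁q∣≤∣p∣ : ∀ {n} (p q : Subset n) → q ⊆ p → ∣ q ∣ + ∣ p ∩ ∁ q ∣ ≤ ∣ p ∣
∣q∣+∣p∩∁q∣≤∣p∣ p q q⊆p =
  ≤-trans (≤-reflexive (sym (disjoint⇒∣p∪q∣ q (p ∩ ∁ q) disjoint)))
          (p⊆q⇒∣p∣≤∣q∣ (∪-lub q⊆p (p∩q⊆p p (∁ q))))
  where
  disjoint : Empty (q ∩ (p ∩ ∁ q))
  disjoint (x , x∈) with x∈p∩q⁻ q (p ∩ ∁ q) x∈
  ... | x∈q , x∈′ = x∈∁p⇒x∉p (p∩q⊆q p (∁ q) x∈′) x∈q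

-- Weights and unions of a family of sets over a vertex set.

module Weights {m n : ℕ} (S : Fin n → Subset m) where

  weight : Subset n → ℕ
  weight X = sum (λ v → χ X v * ∣ S v ∣)

  weight-mono : ∀ {X Y} → X ⊆ Y → weight X ≤ weight Y
  weight-mono X⊆Y = sum-mono-≤ λ v → *-monoˡ-≤ ∣ S v ∣ (χ-mono X⊆Y v)

  weight-modular : ∀ X Y → weight (X ∩ Y) + weight (X ∪ Y) ≡ weight X + weight Y
  weight-modular X Y = begin
    weight (X ∩ Y) + weight (X ∪ Y)
      ≡⟨ ∑-distrib-+ (λ v → χ (X ∩ Y) v * ∣ S v ∣) _ ⟨
    sum (λ v → χ (X ∩ Y) v * ∣ S v ∣ + χ (X ∪ Y) v * ∣ S v ∣)
      ≡⟨ sum-cong-≗ pointwise ⟩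
    sum (λ v → χ X v * ∣ S v ∣ + χ Y v * ∣ S v ∣)
      ≡⟨ ∑-distrib-+ (λ v → χ X v * ∣ S v ∣) _ ⟩
    weight X + weight Y ∎
    where
    open ≡-Reasoning
    pointwise : ∀ v → χ (X ∩ Y) v * ∣ S v ∣ + χ (X ∪ Y) v * ∣ S v ∣ ≡ χ X v * ∣ S v ∣ + χ Y v * ∣ S v ∣
    pointwise v = begin
      χ (X ∩ Y) v * ∣ S v ∣ + χ (X ∪ Y) v * ∣ S v ∣ ≡⟨ *-distribʳ-+ ∣ S v ∣ (χ (X ∩ Y) v) _ ⟨
      (χ (X ∩ Y) v + χ (X ∪ Y) v) * ∣ S v ∣         ≡⟨ cong (_* ∣ S v ∣) (χ-∩∪ X Y v) ⟩
      (χ X v + χ Y v) * ∣ S v ∣                     ≡⟨ *-distribʳ-+ ∣ S v ∣ (χ X v) _ ⟩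
      χ X v * ∣ S v ∣ + χ Y v * ∣ S v ∣             ∎

  weight-∪ : ∀ {X Y Z} → X ⊆ Y ∪ Z → weight X ≤ weight Y + weight Z
  weight-∪ {X} {Y} {Z} X⊆ = ≤-trans (weight-mono X⊆)
    (≤-trans (m≤n+m _ (weight (Y ∩ Z))) (≤-reflexive (weight-modular Y Z)))

  weight-bound : ∀ {k} → (∀ v → ∣ S v ∣ ≤ k) → ∀ X → weight X ≤ k * ∣ X ∣
  weight-bound {k} S≤k X = begin
    sum (λ v → χ X v * ∣ S v ∣) ≤⟨ sum-mono-≤ (λ v → *-monoʳ-≤ (χ X v) (S≤k v)) ⟩
    sum (λ v → χ X v * k)       ≡⟨ sum-cong-≗ (λ v → *-comm (χ X v) k) ⟩
    sum (λ v → k * χ X v)       ≡⟨ *-distribˡ-sum k (χ X) ⟨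
    k * sum (χ X)               ≡⟨ cong (k *_) (∣∣≡∑χ X) ⟨
    k * ∣ X ∣                   ∎
    where
    open ≤-Reasoning

  weight-⊤ : weight ⊤ ≡ sum (λ v → ∣ S v ∣)
  weight-⊤ = sum-cong-≗ λ v → trans (cong (_* ∣ S v ∣) (χ-∈ {p = ⊤} (∈⊤ {x = v}))) (*-identityˡ ∣ S v ∣)

  ⋃ : Subset n → Subset m
  ⋃ X = subsetOf (λ s → any? (λ v → (v ∈? X) ×-dec (s ∈? S v)))

  ∈⋃⁺ : ∀ {X v s} → v ∈ X → s ∈ S v → s ∈ ⋃ X
  ∈⋃⁺ v∈ s∈ = ∈-subsetOf⁺ (λ s → any? (λ v → (v ∈? _) ×-dec (s ∈? S v))) (_ , v∈ , s∈)

  ∈⋃⁻ : ∀ {X s} → s ∈ ⋃ X → ∃[ v ] v ∈ X × s ∈ S v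
  ∈⋃⁻ = ∈-subsetOf⁻ (λ s → any? (λ v → (v ∈? _) ×-dec (s ∈? S v)))

  ⋃-mono : ∀ {X Y} → X ⊆ Y → ⋃ X ⊆ ⋃ Y
  ⋃-mono X⊆Y s∈ with ∈⋃⁻ s∈
  ... | v , v∈ , s∈S = ∈⋃⁺ (X⊆Y v∈) s∈S

  ⋃-∪ : ∀ X Y → ⋃ (X ∪ Y) ⊆ ⋃ X ∪ ⋃ Y
  ⋃-∪ X Y s∈ with ∈⋃⁻ s∈
  ... | v , v∈ , s∈S with x∈p∪q⁻ X Y v∈
  ...   | inj₁ v∈X = p⊆p∪q (⋃ Y) (∈⋃⁺ v∈X s∈S)
  ...   | inj₂ v∈Y = q⊆p∪q (⋃ X) (⋃ Y) (∈⋃⁺ v∈Y s∈S)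

open Weights

-- Feasible states, uncrossing, and the search for a usable edge.

module Decompose (G : Graph) {t : ℕ} (M : Matroid t) (k : ℕ) (rank⊤ : Matroid.rank M ⊤ ≡ k) where
  open Graph G
  open GraphLemmas G
  open RootedTrees G
  open Matroid M
  open MatroidRank M

  E[_] : Subset #V → Subset #E
  E[ X ] = subsetOf (λ e → (src e ∈? X) ×-dec (tgt e ∈? X))

  ∈E⁺ : ∀ {X e} → src e ∈ X × tgt e ∈ X → e ∈ E[ X ]
  ∈E⁺ = ∈-subsetOf⁺ (λ e → (src e ∈? _) ×-dec (tgt e ∈? _))

  ∈E⁻ : ∀ {X e} → e ∈ E[ X ] → src e ∈ X × tgt e ∈ X
  ∈E⁻ = ∈-subsetOf⁻ (λ e → (src e ∈? _) ×-dec (tgt e ∈? _))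

  E-mono : ∀ {X Y} → X ⊆ Y → E[ X ] ⊆ E[ Y ]
  E-mono X⊆Y = ∈E⁺ ∘ map X⊆Y X⊆Y ∘ ∈E⁻

  indep⇒≤k : ∀ {I} → Indep I → ∣ I ∣ ≤ k
  indep⇒≤k {I} ind = ≤-trans (indep⇒∣∣≤rank ind (⊆-max I)) (≤-reflexive rank⊤)

  rank≤k : ∀ S → rank S ≤ k
  rank≤k S = ≤-trans (rank-mono (⊆-max S)) (≤-reflexive rank⊤)

  -- If the edges of A are oriented so that v has in-degree k ∸ ∣ S v ∣, then
  -- k * ∣ X ∣ ∸ demand A S X is the number of edges entering X.
  demand : Subset #E → (Vertex → Subset t) → Subset #V → ℕ
  demand A S X = ∣ E[ X ] ∩ A ∣ + weight S X

  -- The equation `total` guarantees a vertex with fewer than `k` elements while edges remain, and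
  -- forces all sets to be bases once none remain.
  record Feasible (A : Subset #E) (S : Vertex → Subset t) : Set where
    field
      indep : ∀ v → Indep (S v)
      total : ∣ A ∣ + sum (λ v → ∣ S v ∣) ≡ k * #V
      cond  : ∀ X → Nonempty X → demand A S X + k ≤ k * ∣ X ∣ + rank (⋃ S X)

  -- The sets `Y` in `non-blocking` are those whose weight rises by one without losing an edge of
  -- `A`; the strict inequality pays for that unit.
  record Extension (A : Subset #E) (S : Vertex → Subset t) : Set where
    constructor extension
    field
      {edge}       : Edge
      {from to}    : Vertex
      {element}    : Fin t
      edge∈        : edge ∈ A
      joins        : Joins edge from to
      element∈     : element ∈ S from
      element∉     : element ∉ S to
      independent  : Indep (S to ∪ ⁅ element ⁆)
      non-blocking : ∀ Y → to ∈ Y → from ∉ Y →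
                     demand A S Y + k < k * ∣ Y ∣ + rank (⋃ S Y ∪ ⁅ element ⁆)

  -- Weights are modular. Edges inside both sets lie inside the intersection and edges inside either
  -- lie inside the union, which may contain further edges across.
  demand-supermodular : ∀ A S X Y → demand A S X + demand A S Y ≤ demand A S (X ∩ Y) + demand A S (X ∪ Y)
  demand-supermodular A S X Y = begin
    (∣ P ∣ + weight S X) + (∣ Q ∣ + weight S Y)  ≡⟨ shuffle (∣ P ∣) (weight S X) (∣ Q ∣) (weight S Y) ⟩
    (∣ P ∣ + ∣ Q ∣) + (weight S X + weight S Y)  ≡⟨ cong₂ _+_ (∣p∩q∣+∣p∪q∣ P Q) (weight-modular S X Y) ⟨
    (∣ P ∩ Q ∣ + ∣ P ∪ Q ∣) + (weight S (X ∩ Y) + weight S (X ∪ Y))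
      ≤⟨ +-monoˡ-≤ _ (+-mono-≤ (p⊆q⇒∣p∣≤∣q∣ ∩⊆) (p⊆q⇒∣p∣≤∣q∣ ∪⊆)) ⟩
    (∣ E[ X ∩ Y ] ∩ A ∣ + ∣ E[ X ∪ Y ] ∩ A ∣) + (weight S (X ∩ Y) + weight S (X ∪ Y))
      ≡⟨ shuffle (∣ E[ X ∩ Y ] ∩ A ∣) (weight S (X ∩ Y)) _ _ ⟨
    demand A S (X ∩ Y) + demand A S (X ∪ Y)      ∎
    where
    open ≤-Reasoning
    P Q : Subset #E
    P = E[ X ] ∩ A
    Q = E[ Y ] ∩ A
    shuffle : ∀ a b c d → (a + b) + (c + d) ≡ (a + c) + (b + d)
    shuffle = solve-∀
    ∩⊆ : P ∩ Q ⊆ E[ X ∩ Y ] ∩ A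
    ∩⊆ e∈ with x∈p∩q⁻ P Q e∈
    ... | e∈P , e∈Q with ∈E⁻ (p∩q⊆p E[ X ] A e∈P) | ∈E⁻ (p∩q⊆p E[ Y ] A e∈Q)
    ...   | sX , tX | sY , tY =
      x∈p∩q⁺ (∈E⁺ (x∈p∩q⁺ (sX , sY) , x∈p∩q⁺ (tX , tY)) , p∩q⊆q E[ X ] A e∈P)
    ∩A-mono : ∀ {X Y} → X ⊆ Y → E[ X ] ∩ A ⊆ E[ Y ] ∩ A
    ∩A-mono {X} X⊆Y e∈ = x∈p∩q⁺ (E-mono X⊆Y (p∩q⊆p E[ X ] A e∈) , p∩q⊆q E[ X ] A e∈)
    ∪⊆ : P ∪ Q ⊆ E[ X ∪ Y ] ∩ A
    ∪⊆ = ∪-lub (∩A-mono (p⊆p∪q Y)) (∩A-mono (q⊆p∪q X Y))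

  module Search {A S} (feasible : Feasible A S) where
    open Feasible feasible

    -- The reverse of `cond`; on a non-empty set the two amount to equality.
    Tight : Subset #V → Set
    Tight X = k * ∣ X ∣ + rank (⋃ S X) ≤ demand A S X + k

    -- For non-empty `Z` the rank in `cond` is at most `k` and cancels. The empty set is treated
    -- separately because the part cut off in `unspanned-edge` may be empty.
    demand-bound : ∀ Z → demand A S Z ≤ k * ∣ Z ∣
    demand-bound Z with nonempty? Z
    ... | yes ne = +-cancelʳ-≤ k _ _ (≤-trans (cond Z ne) (+-monoʳ-≤ (k * ∣ Z ∣) (rank≤k (⋃ S Z))))
    ... | no  ∅  = ≤-trans (≤-reflexive (cong (_+ weight S Z) inner≡0))
                           (weight-bound S (indep⇒≤k ∘ indep) Z)
      where
      inner≡0 : ∣ E[ Z ] ∩ A ∣ ≡ 0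
      inner≡0 = trans (cong ∣_∣ (Empty-unique λ (e , e∈) →
                         ∅ (src e , proj₁ (∈E⁻ (p∩q⊆p E[ Z ] A e∈)))))
                      (∣⊥∣≡0 #E)

    -- If the union raised the rank, a single element of it could be added to `S v` independently;
    -- that element belongs to some `S w`, which `S v` spans.
    spans-⋃ : ∀ v W → (∀ {w} → w ∈ W → S v Spans S w) → S v Spans ⋃ S W
    spans-⋃ v W spans with S v spans? ⋃ S W
    ... | yes sp = sp
    ... | no ¬sp with unspanned (indep v) ¬sp
    ...   | s , s∈ , s∉ , ind with ∈⋃⁻ S s∈
    ...     | w , w∈ , s∈w = contradiction
      (begin
        suc (rank (S v))     ≡⟨ cong suc (rank-indep (indep v)) ⟩
        suc ∣ S v ∣          ≡⟨ ∣p∪⁅x⁆∣ s∉ ⟨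
        ∣ S v ∪ ⁅ s ⁆ ∣      ≤⟨ indep⇒∣∣≤rank ind (∪-mono id (⁅x⁆⊆ s∈w)) ⟩
        rank (S v ∪ S w)     ≤⟨ spans w∈ ⟩
        rank (S v)           ∎)
      1+n≰n
      where open ≤-Reasoning

    -- The vertices of X whose sets are spanned by S v cannot be separated from
    -- the rest of X, since demand would then split additively.
    unspanned-edge : ∀ {X v} → Tight X → v ∈ X → rank (S v) < rank (⋃ S X) →
                     ∃[ e ] ∃[ u ] ∃[ w ] e ∈ A × Joins e u w × u ∈ X × w ∈ X × ¬ (S w Spans S u)
    unspanned-edge {X} {v} tight v∈X r< = go (leaving-or-closed (E[ X ] ∩ A) W)
      where
      W? : Decidable (λ w → w ∈ X × S v Spans S w)
      W? w = (w ∈? X) ×-dec (S v spans? S w)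
      W Z : Subset #V
      W = subsetOf W?
      Z = X ∩ ∁ W
      W⊆X : W ⊆ X
      W⊆X = proj₁ ∘ ∈-subsetOf⁻ W?
      v∈W : v ∈ W
      v∈W = ∈-subsetOf⁺ W? (v∈X , spans-refl)
      rank-W : rank (⋃ S W) ≤ rank (S v)
      rank-W = ≤-trans (rank-mono (q⊆p∪q (S v) (⋃ S W)))
                       (spans-⋃ v W (proj₂ ∘ ∈-subsetOf⁻ W?))

      go : ∃ (Leaving (E[ X ] ∩ A) W) ⊎ Closed (E[ X ] ∩ A) W →
           ∃[ e ] ∃[ u ] ∃[ w ] e ∈ A × Joins e u w × u ∈ X × w ∈ X × ¬ (S w Spans S u)
      -- If `S w` spanned `S u`, then by transitivity so would `S v`, and `u` would belong to `W`.
      go (inj₁ (e , w , u , e∈ , j , w∈ , u∉)) =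
        e , u , w , p∩q⊆q E[ X ] A e∈ , joins-sym j , u∈X , W⊆X w∈ ,
        λ w→u → u∉ (∈-subsetOf⁺ W? (u∈X , spans-trans {P = S w} (proj₂ (∈-subsetOf⁻ W? w∈)) w→u))
        where
        u∈X : u ∈ X
        u∈X = proj₂ (∈-joins j (∈E⁻ (p∩q⊆p E[ X ] A e∈)))
      go (inj₂ closed) = contradiction r≤ (<⇒≱ r<)
        where
        open ≤-Reasoning
        split : E[ X ] ∩ A ⊆ (E[ W ] ∩ A) ∪ (E[ Z ] ∩ A)
        split {e} e∈ with x∈p∩q⁻ E[ X ] A e∈ | src e ∈? W
        ... | e∈X , e∈A | yes s∈ =
          p⊆p∪q (E[ Z ] ∩ A) (x∈p∩q⁺ (∈E⁺ (s∈ , closed e∈ (inj₁ refl) s∈) , e∈A))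
        ... | e∈X , e∈A | no  s∉ =
          q⊆p∪q (E[ W ] ∩ A) (E[ Z ] ∩ A) (x∈p∩q⁺
            (∈E⁺ ( x∈p∩q⁺ (proj₁ (∈E⁻ e∈X) , x∉p⇒x∈∁p s∉)
                 , x∈p∩q⁺ (proj₂ (∈E⁻ e∈X) , x∉p⇒x∈∁p (s∉ ∘ closed e∈ (inj₂ refl)))) , e∈A))
        shuffle : ∀ a b c d k → (a + b) + (c + d) + k ≡ (a + c + k) + (b + d)
        shuffle = solve-∀
        collect : ∀ k w z r → k * w + r + k * z ≡ k * (w + z) + r
        collect = solve-∀
        r≤ : rank (⋃ S X) ≤ rank (S v)
        r≤ = +-cancelˡ-≤ (k * ∣ X ∣) _ _ (begin
          k * ∣ X ∣ + rank (⋃ S X)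
            ≤⟨ tight ⟩
          ∣ E[ X ] ∩ A ∣ + weight S X + k
            ≤⟨ +-monoˡ-≤ k (+-mono-≤ (≤-trans (p⊆q⇒∣p∣≤∣q∣ split) (∣p∪q∣≤∣p∣+∣q∣ (E[ W ] ∩ A) (E[ Z ] ∩ A)))
                                     (weight-∪ S (∩∁-split W⊆X))) ⟩
          (∣ E[ W ] ∩ A ∣ + ∣ E[ Z ] ∩ A ∣) + (weight S W + weight S Z) + k
            ≡⟨ shuffle (∣ E[ W ] ∩ A ∣) (∣ E[ Z ] ∩ A ∣) (weight S W) (weight S Z) k ⟩
          (demand A S W + k) + demand A S Z
            ≤⟨ +-mono-≤ (≤-trans (cond W (v , v∈W)) (+-monoʳ-≤ (k * ∣ W ∣) rank-W)) (demand-bound Z) ⟩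
          k * ∣ W ∣ + rank (S v) + k * ∣ Z ∣
            ≡⟨ collect k (∣ W ∣) (∣ Z ∣) (rank (S v)) ⟩
          k * (∣ W ∣ + ∣ Z ∣) + rank (S v)
            ≤⟨ +-monoˡ-≤ (rank (S v)) (*-monoʳ-≤ k (∣q∣+∣p∩∁q∣≤∣p∣ X W W⊆X)) ⟩
          k * ∣ X ∣ + rank (S v) ∎)

    -- Submodularity of the rank for `⋃ S X` and `⋃ S Y ∪ ⁅ s ⁆` meets supermodularity of the
    -- demand. Since `s` lies in both sets it survives in the intersection, and `cond` for `X ∪ Y`
    -- cancels the union terms.
    uncross : ∀ {X Y s w} → Tight X → s ∈ ⋃ S X → w ∈ X →
              k * ∣ Y ∣ + rank (⋃ S Y ∪ ⁅ s ⁆) ≤ demand A S Y + k →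
              k * ∣ X ∩ Y ∣ + rank (⋃ S (X ∩ Y) ∪ ⁅ s ⁆) ≤ demand A S (X ∩ Y) + k
    uncross {X} {Y} {s} {w} tight s∈X w∈X blocking =
      +-cancelʳ-≤ (k * ∣ X ∪ Y ∣ + rank (⋃ S (X ∪ Y))) _ _ (begin
        (k * ∣ X ∩ Y ∣ + rank (⋃ S (X ∩ Y) ∪ ⁅ s ⁆)) + (k * ∣ X ∪ Y ∣ + rank (⋃ S (X ∪ Y)))
          ≡⟨ collect k (∣ X ∩ Y ∣) _ (∣ X ∪ Y ∣) _ ⟩
        k * (∣ X ∩ Y ∣ + ∣ X ∪ Y ∣) + (rank (⋃ S (X ∩ Y) ∪ ⁅ s ⁆) + rank (⋃ S (X ∪ Y)))
          ≤⟨ +-mono-≤ (≤-reflexive (cong (k *_) (∣p∩q∣+∣p∪q∣ X Y))) ranks ⟩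
        k * (∣ X ∣ + ∣ Y ∣) + (rank P + rank Q)
          ≡⟨ collect k (∣ X ∣) _ (∣ Y ∣) _ ⟨
        (k * ∣ X ∣ + rank P) + (k * ∣ Y ∣ + rank Q)
          ≤⟨ +-mono-≤ tight blocking ⟩
        (demand A S X + k) + (demand A S Y + k)
          ≡⟨ shuffle (demand A S X) _ k ⟩
        (demand A S X + demand A S Y) + (k + k)
          ≤⟨ +-monoˡ-≤ (k + k) (demand-supermodular A S X Y) ⟩
        (demand A S (X ∩ Y) + demand A S (X ∪ Y)) + (k + k)
          ≡⟨ shuffle (demand A S (X ∩ Y)) _ k ⟨
        (demand A S (X ∩ Y) + k) + (demand A S (X ∪ Y) + k)
          ≤⟨ +-monoʳ-≤ (demand A S (X ∩ Y) + k) (cond (X ∪ Y) (w , p⊆p∪q Y w∈X)) ⟩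
        (demand A S (X ∩ Y) + k) + (k * ∣ X ∪ Y ∣ + rank (⋃ S (X ∪ Y))) ∎)
      where
      open ≤-Reasoning
      P Q : Subset t
      P = ⋃ S X
      Q = ⋃ S Y ∪ ⁅ s ⁆
      collect : ∀ k a r b q → (k * a + r) + (k * b + q) ≡ k * (a + b) + (r + q)
      collect = solve-∀
      shuffle : ∀ a b k → (a + k) + (b + k) ≡ (a + b) + (k + k)
      shuffle = solve-∀
      ⊆P : ⋃ S (X ∩ Y) ∪ ⁅ s ⁆ ⊆ P
      ⊆P = ∪-lub (⋃-mono S (p∩q⊆p X Y)) (⁅x⁆⊆ s∈X)
      ⊆Q : ⋃ S (X ∩ Y) ∪ ⁅ s ⁆ ⊆ Q
      ⊆Q = ∪-mono (⋃-mono S (p∩q⊆q X Y)) id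
      ranks : rank (⋃ S (X ∩ Y) ∪ ⁅ s ⁆) + rank (⋃ S (X ∪ Y)) ≤ rank P + rank Q
      ranks = ≤-trans
        (+-mono-≤ (rank-mono {S′ = P ∩ Q} (λ x∈ → x∈p∩q⁺ (⊆P x∈ , ⊆Q x∈)))
                  (rank-mono {S′ = P ∪ Q} (∪-mono id (p⊆p∪q ⁅ s ⁆) ∘ ⋃-∪ S X Y)))
        (rank-submodular P Q)

    -- The pair of a tight set and a vertex not spanning it is the invariant. A set blocking the
    -- chosen edge replaces `X` by `X ∩ Y`, which loses `u`, and `v` by `w`; `n` bounds the size of
    -- the current set.
    search : ∀ n {X v} → ∣ X ∣ ≤ n → Tight X → v ∈ X → rank (S v) < rank (⋃ S X) → Extension A S
    search zero ∣X∣≤ tight v∈X r< = contradiction (_ , v∈X) (∣p∣≡0⇒Empty (n≤0⇒n≡0 ∣X∣≤))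
    search (suc n) {X} ∣X∣≤ tight v∈X r< with unspanned-edge tight v∈X r<
    ... | e , u , w , e∈ , j , u∈X , w∈X , ¬sp with unspanned (indep w) ¬sp
    ...   | s , s∈u , s∉w , ind
      -- A blocking set is one that violates the inequality of `non-blocking`; all vertex sets are
      -- tried.
      with anySubset? (λ Y → (w ∈? Y) ×-dec ¬? (u ∈? Y) ×-dec
                             (k * ∣ Y ∣ + rank (⋃ S Y ∪ ⁅ s ⁆) ≤? demand A S Y + k))
    ...     | no none = extension e∈ j s∈u s∉w ind λ Y w∈ u∉ → ≰⇒> λ blocking → none (Y , w∈ , u∉ , blocking)
    ...     | yes (Y , w∈Y , u∉Y , blocking) =
      search n (≤-pred (≤-trans (p⊂q⇒∣p∣<∣q∣ X∩Y⊂X) ∣X∣≤))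
             (≤-trans (+-monoʳ-≤ (k * ∣ X ∩ Y ∣) (rank-mono (p⊆p∪q ⁅ s ⁆))) uncrossed)
             w∈X∩Y rank-w<
      where
      open ≤-Reasoning
      w∈X∩Y : w ∈ X ∩ Y
      w∈X∩Y = x∈p∩q⁺ (w∈X , w∈Y)
      X∩Y⊂X : X ∩ Y ⊂ X
      X∩Y⊂X = p∩q⊆p X Y , u , u∈X , u∉Y ∘ p∩q⊆q X Y
      uncrossed : k * ∣ X ∩ Y ∣ + rank (⋃ S (X ∩ Y) ∪ ⁅ s ⁆) ≤ demand A S (X ∩ Y) + k
      uncrossed = uncross tight (∈⋃⁺ S u∈X s∈u) w∈X blocking
      -- Comparing `uncrossed` with `cond` shows that `s` is spanned by `⋃ S (X ∩ Y)`, whereas it is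
      -- independent of `S w`.
      rank-w< : rank (S w) < rank (⋃ S (X ∩ Y))
      rank-w< = begin
        suc (rank (S w))              ≡⟨ cong suc (rank-indep (indep w)) ⟩
        suc ∣ S w ∣                   ≡⟨ ∣p∪⁅x⁆∣ s∉w ⟨
        ∣ S w ∪ ⁅ s ⁆ ∣               ≤⟨ indep⇒∣∣≤rank ind (∪-mono (∈⋃⁺ S w∈X∩Y) id) ⟩
        rank (⋃ S (X ∩ Y) ∪ ⁅ s ⁆)    ≤⟨ +-cancelˡ-≤ (k * ∣ X ∩ Y ∣) _ _
                                           (≤-trans uncrossed (cond (X ∩ Y) (w , w∈X∩Y))) ⟩
        rank (⋃ S (X ∩ Y))            ∎

    demand-⊤ : demand A S ⊤ ≡ k * #V
    demand-⊤ = trans (cong₂ _+_ (cong ∣_∣ E[⊤]∩A≡A) (weight-⊤ S)) total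
      where
      E[⊤]∩A≡A : E[ ⊤ ] ∩ A ≡ A
      E[⊤]∩A≡A = ⊆-antisym (p∩q⊆q E[ ⊤ ] A) (λ e∈ → x∈p∩q⁺ (∈E⁺ (∈⊤ , ∈⊤) , e∈))

    extend-packing : 0 < ∣ A ∣ → Extension A S
    extend-packing 0<∣A∣ with any? (λ v → ∣ S v ∣ <? k)
    ... | no none = contradiction
      (begin-strict
        k * #V                           ≡⟨ sum-const #V k ⟨
        sum {#V} (λ _ → k)               ≤⟨ sum-mono-≤ (λ v → ≮⇒≥ (none ∘ (v ,_))) ⟩
        sum (λ v → ∣ S v ∣)              <⟨ +-monoˡ-< (sum (λ v → ∣ S v ∣)) 0<∣A∣ ⟩
        ∣ A ∣ + sum (λ v → ∣ S v ∣)      ≡⟨ total ⟩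
        k * #V                           ∎)
      (<-irrefl refl)
      where open ≤-Reasoning
    ... | yes (v , Sv<k) = search ∣ ⊤ {#V} ∣ ≤-refl
      (≤-trans (+-mono-≤ (≤-reflexive k*∣⊤∣) (rank≤k (⋃ S ⊤))) (≤-reflexive (cong (_+ k) (sym demand-⊤))))
      (∈⊤ {x = v})
      (≤-trans (≤-trans (≤-reflexive (cong suc (rank-indep (indep v)))) Sv<k)
               (+-cancelˡ-≤ (k * #V) _ _
                 (≤-trans (≤-reflexive (cong (_+ k) (sym demand-⊤)))
                          (≤-trans (cond ⊤ (v , ∈⊤)) (≤-reflexive (cong (_+ rank (⋃ S ⊤)) k*∣⊤∣))))))
      where
      k*∣⊤∣ : k * ∣ ⊤ {#V} ∣ ≡ k * #V
      k*∣⊤∣ = cong (k *_) (∣⊤∣≡n #V)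

-- Double counting, and the change of weight under one attachment.

∣p∣≡1+∣p∩∁⁅x⁆∣ : ∀ {n} {p : Subset n} {x} → x ∈ p → ∣ p ∣ ≡ suc ∣ p ∩ ∁ ⁅ x ⁆ ∣
∣p∣≡1+∣p∩∁⁅x⁆∣ {p = p} {x} x∈p = trans (cong ∣_∣ (⊆-antisym ⊆₁ ⊆₂)) (∣p∪⁅x⁆∣ x∉)
  where
  x∉ : x ∉ p ∩ ∁ ⁅ x ⁆
  x∉ x∈ = x∈∁p⇒x∉p (p∩q⊆q p (∁ ⁅ x ⁆) x∈) (x∈⁅x⁆ x)
  ⊆₁ : p ⊆ (p ∩ ∁ ⁅ x ⁆) ∪ ⁅ x ⁆
  ⊆₁ {y} y∈p with y ≟ x
  ... | yes refl = x∈p∪⁅x⁆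
  ... | no  y≢x  = p⊆p∪q ⁅ x ⁆ (x∈p∩q⁺ (y∈p , x∉p⇒x∈∁p (x≢y⇒x∉⁅y⁆ y≢x)))
  ⊆₂ : (p ∩ ∁ ⁅ x ⁆) ∪ ⁅ x ⁆ ⊆ p
  ⊆₂ = ∪-lub (p∩q⊆p p (∁ ⁅ x ⁆)) (⁅x⁆⊆ x∈p)

χ-∩ : ∀ {n} (p q : Subset n) x → χ (p ∩ q) x ≡ χ p x * χ q x
χ-∩ p q x rewrite lookup-zipWith _∧_ x p q with lookup p x | lookup q x
... | inside  | inside  = refl
... | inside  | outside = refl
... | outside | _       = refl

-- Exchange of the two summations over incidences. With `k` equal to 1 and singletons for `B` it
-- also counts edges by their tree and roots by their vertex.
double-count : ∀ {m n k} {U : Fin m → Subset n} {B : Fin n → Subset m} →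
               (∀ {i x} → x ∈ U i → i ∈ B x) → (∀ {i x} → i ∈ B x → x ∈ U i) →
               (∀ x → ∣ B x ∣ ≡ k) → ∀ X → sum (λ i → ∣ X ∩ U i ∣) ≡ k * ∣ X ∣
double-count {k = k} {U} {B} U⇒B B⇒U ∣B∣≡k X = begin
  sum (λ i → ∣ X ∩ U i ∣)
    ≡⟨ sum-cong-≗ (λ i → trans (∣∣≡∑χ (X ∩ U i)) (sum-cong-≗ (χ-∩ X (U i)))) ⟩
  sum (λ i → sum (λ x → χ X x * χ (U i) x))
    ≡⟨ ∑-comm (λ i x → χ X x * χ (U i) x) ⟩
  sum (λ x → sum (λ i → χ X x * χ (U i) x))
    ≡⟨ sum-cong-≗ (λ x → sum-cong-≗ (λ i → cong (χ X x *_) (χ-cong (U⇒B {i} {x}) B⇒U))) ⟩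
  sum (λ x → sum (λ i → χ X x * χ (B x) i))
    ≡⟨ sum-cong-≗ (λ x → *-distribˡ-sum (χ X x) (χ (B x))) ⟨
  sum (λ x → χ X x * sum (χ (B x)))
    ≡⟨ sum-cong-≗ (λ x → trans (cong (χ X x *_) (trans (sym (∣∣≡∑χ (B x))) (∣B∣≡k x))) (*-comm (χ X x) k)) ⟩
  sum (λ x → k * χ X x)
    ≡⟨ *-distribˡ-sum k (χ X) ⟨
  k * sum (χ X)
    ≡⟨ cong (k *_) (∣∣≡∑χ X) ⟨
  k * ∣ X ∣ ∎
  where open ≡-Reasoning

weight-attach : ∀ {m n} (S : Fin n → Subset m) {v s} → s ∉ S v → ∀ X →
                weight (attach S v s) X ≡ weight S X + χ X v
weight-attach S {v} {s} s∉ X = sum-update v (χ X v)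
  (λ w w≢v → cong (λ P → χ X w * ∣ P ∣) (sym (attach-other S s w≢v)))
  (begin
    χ X v * ∣ attach S v s v ∣  ≡⟨ cong (λ P → χ X v * ∣ P ∣) (attach-at S v s) ⟩
    χ X v * ∣ S v ∪ ⁅ s ⁆ ∣     ≡⟨ cong (χ X v *_) (∣p∪⁅x⁆∣ s∉) ⟩
    χ X v * suc ∣ S v ∣         ≡⟨ *-suc (χ X v) ∣ S v ∣ ⟩
    χ X v + χ X v * ∣ S v ∣     ≡⟨ +-comm (χ X v) _ ⟩
    χ X v * ∣ S v ∣ + χ X v     ∎)
  where open ≡-Reasoning

-- Sufficiency: growing the packing edge by edge.

module Sufficiency (G : Graph) {t : ℕ} (M : Matroid t) (k : ℕ) (rank⊤ : Matroid.rank M ⊤ ≡ k)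
                   (R : Fin t → Graph.Vertex G) where
  open Graph G
  open GraphLemmas G
  open RootedTrees G
  open Matroid M
  open MatroidRank M
  open Decompose G M k rank⊤

  -- Only sets containing `to` gain weight. If `from` also lies in the set, the lost edge
  -- compensates; if not, `non-blocking` supplies the missing unit and the union gains `element`.
  feasible-attach : ∀ {A S} → Feasible A S → (ext : Extension A S) → let open Extension ext in
                    Feasible (A ∩ ∁ ⁅ edge ⁆) (attach S to element)
  feasible-attach {A} {S} feasible ext = record { indep = indep′ ; total = total′ ; cond = cond′ }
    where
    open Feasible feasible
    open Extension ext
    A′ : Subset #E
    A′ = A ∩ ∁ ⁅ edge ⁆
    S′ : Vertex → Subset t
    S′ = attach S to element
    indep′ : ∀ v → Indep (S′ v)
    indep′ v with v ≟ to
    ... | yes refl = subst Indep (sym (attach-at S to element)) independent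
    ... | no  v≢to = subst Indep (sym (attach-other S element v≢to)) (indep v)
    total′ : ∣ A′ ∣ + sum (λ v → ∣ S′ v ∣) ≡ k * #V
    total′ = begin
      ∣ A′ ∣ + sum (λ v → ∣ S′ v ∣)       ≡⟨ cong (∣ A′ ∣ +_) (weight-⊤ S′) ⟨
      ∣ A′ ∣ + weight S′ ⊤                ≡⟨ cong (∣ A′ ∣ +_) (weight-attach S element∉ ⊤) ⟩
      ∣ A′ ∣ + (weight S ⊤ + χ ⊤ to)      ≡⟨ cong (λ c → ∣ A′ ∣ + (weight S ⊤ + c)) (χ-∈ {p = ⊤} (∈⊤ {x = to})) ⟩
      ∣ A′ ∣ + (weight S ⊤ + 1)           ≡⟨ shuffle (∣ A′ ∣) (weight S ⊤) ⟩
      suc ∣ A′ ∣ + weight S ⊤             ≡⟨ cong₂ _+_ (sym (∣p∣≡1+∣p∩∁⁅x⁆∣ edge∈)) (weight-⊤ S) ⟩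
      ∣ A ∣ + sum (λ v → ∣ S v ∣)         ≡⟨ total ⟩
      k * #V                              ∎
      where
      open ≡-Reasoning
      shuffle : ∀ a b → a + (b + 1) ≡ suc a + b
      shuffle = solve-∀
    inner⊆ : ∀ X → E[ X ] ∩ A′ ⊆ E[ X ] ∩ A
    inner⊆ X e∈ = x∈p∩q⁺ (p∩q⊆p E[ X ] A′ e∈ , p∩q⊆p A (∁ ⁅ edge ⁆) (p∩q⊆q E[ X ] A′ e∈))
    ⋃⊆ : ∀ X → ⋃ S X ⊆ ⋃ S′ X
    ⋃⊆ X s∈ with ∈⋃⁻ S s∈
    ... | v , v∈ , s∈v = ∈⋃⁺ S′ v∈ (attach-⊇ S to element v s∈v)
    cond′ : ∀ X → Nonempty X → demand A′ S′ X + k ≤ k * ∣ X ∣ + rank (⋃ S′ X)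
    cond′ X ne rewrite weight-attach S element∉ X with to ∈? X | from ∈? X
    ... | no to∉ | _ rewrite χ-∉ to∉ | +-identityʳ (weight S X) = begin
      ∣ E[ X ] ∩ A′ ∣ + weight S X + k
        ≤⟨ +-monoˡ-≤ k (+-monoˡ-≤ (weight S X) (p⊆q⇒∣p∣≤∣q∣ (inner⊆ X))) ⟩
      demand A S X + k            ≤⟨ cond X ne ⟩
      k * ∣ X ∣ + rank (⋃ S X)    ≤⟨ +-monoʳ-≤ (k * ∣ X ∣) (rank-mono (⋃⊆ X)) ⟩
      k * ∣ X ∣ + rank (⋃ S′ X)   ∎
      where open ≤-Reasoning
    ... | yes to∈ | yes from∈ rewrite χ-∈ to∈ = begin
      ∣ E[ X ] ∩ A′ ∣ + (weight S X + 1) + k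
        ≡⟨ shuffle (∣ E[ X ] ∩ A′ ∣) (weight S X) k ⟩
      suc ∣ E[ X ] ∩ A′ ∣ + weight S X + k
        ≤⟨ +-monoˡ-≤ k (+-monoˡ-≤ (weight S X) (p⊂q⇒∣p∣<∣q∣ inner⊂)) ⟩
      demand A S X + k            ≤⟨ cond X ne ⟩
      k * ∣ X ∣ + rank (⋃ S X)    ≤⟨ +-monoʳ-≤ (k * ∣ X ∣) (rank-mono (⋃⊆ X)) ⟩
      k * ∣ X ∣ + rank (⋃ S′ X)   ∎
      where
      open ≤-Reasoning
      shuffle : ∀ a b c → a + (b + 1) + c ≡ suc a + b + c
      shuffle = solve-∀
      inner⊂ : E[ X ] ∩ A′ ⊂ E[ X ] ∩ A
      inner⊂ = inner⊆ X , edge , x∈p∩q⁺ (∈E⁺ (joins-∈ joins from∈ to∈) , edge∈) ,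
               λ e∈ → x∈∁p⇒x∉p (p∩q⊆q A (∁ ⁅ edge ⁆) (p∩q⊆q E[ X ] A′ e∈)) (x∈⁅x⁆ edge)
    ... | yes to∈ | no from∉ rewrite χ-∈ to∈ = begin
      ∣ E[ X ] ∩ A′ ∣ + (weight S X + 1) + k
        ≡⟨ shuffle (∣ E[ X ] ∩ A′ ∣) (weight S X) k ⟩
      suc (∣ E[ X ] ∩ A′ ∣ + weight S X + k)
        ≤⟨ s≤s (+-monoˡ-≤ k (+-monoˡ-≤ (weight S X) (p⊆q⇒∣p∣≤∣q∣ (inner⊆ X)))) ⟩
      suc (demand A S X + k)                      ≤⟨ non-blocking X to∈ from∉ ⟩
      k * ∣ X ∣ + rank (⋃ S X ∪ ⁅ element ⁆)      ≤⟨ +-monoʳ-≤ (k * ∣ X ∣) (rank-mono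
                                                      (∪-lub (⋃⊆ X) (⁅x⁆⊆ (∈⋃⁺ S′ to∈ (∈-attach S to element))))) ⟩
      k * ∣ X ∣ + rank (⋃ S′ X)                   ∎
      where
      open ≤-Reasoning
      shuffle : ∀ a b c → a + (b + 1) + c ≡ suc (a + b + c)
      shuffle = solve-∀

  -- The partial state of the construction. The same incidences are stored by tree in `spanned`, for
  -- growing, and by vertex in `covering`, for the matroid conditions.
  record Packing (A : Subset #E) : Set where
    field
      trees    : Fin t → Subset #E
      spanned  : Fin t → Subset #V
      covering : Vertex → Subset t
      grown    : ∀ i → Grown (R i) (trees i) (spanned i)
      to-covering   : ∀ {i v} → v ∈ spanned i → i ∈ covering v
      from-covering : ∀ {v i} → i ∈ covering v → v ∈ spanned i
      disjoint : ∀ {i j e} → e ∈ trees i → e ∈ trees j → i ≡ j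
      unused   : ∀ {i e} → e ∈ trees i → e ∉ A
      cover    : ∀ e → e ∈ A ⊎ ∃[ i ] e ∈ trees i
      feasible : Feasible A covering

  packing-step : ∀ {A} → 0 < ∣ A ∣ → Packing A → ∃[ A′ ] ∣ A ∣ ≡ suc ∣ A′ ∣ × Packing A′
  packing-step {A} 0<∣A∣ P = A ∩ ∁ ⁅ edge ⁆ , ∣p∣≡1+∣p∩∁⁅x⁆∣ edge∈ , record
    { trees         = attach trees element edge
    ; spanned       = attach spanned element to
    ; covering      = attach covering to element
    ; grown         = grown′
    ; to-covering   = attach-transpose to-covering
    ; from-covering = attach-transpose from-covering
    ; disjoint      = disjoint′
    ; unused        = unused′
    ; cover         = cover′
    ; feasible      = feasible-attach feasible ext
    }
    where
    open Packing P
    ext : Extension A covering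
    ext = Search.extend-packing feasible 0<∣A∣
    open Extension ext
    grown′ : ∀ i → Grown (R i) (attach trees element edge i) (attach spanned element to i)
    grown′ i with i ≟ element
    ... | yes refl rewrite attach-at trees element edge | attach-at spanned element to =
      -- The tree of `element` reaches `from` but not `to`, so `edge` is attached to it as a leaf
      -- edge.
      grow (grown element) joins (from-covering element∈) (element∉ ∘ to-covering)
    ... | no i≢ rewrite attach-other trees edge i≢ | attach-other spanned to i≢ = grown i
    disjoint′ : ∀ {i j e} → e ∈ attach trees element edge i → e ∈ attach trees element edge j → i ≡ j
    disjoint′ e∈i e∈j with ∈-attach⁻ trees e∈i | ∈-attach⁻ trees e∈j
    ... | inj₁ e∈i′       | inj₁ e∈j′         = disjoint e∈i′ e∈j′
    ... | inj₁ e∈i′       | inj₂ (_ , refl)   = contradiction edge∈ (unused e∈i′)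
    ... | inj₂ (_ , refl) | inj₁ e∈j′         = contradiction edge∈ (unused e∈j′)
    ... | inj₂ (refl , _) | inj₂ (refl , _)   = refl
    unused′ : ∀ {i e} → e ∈ attach trees element edge i → e ∉ A ∩ ∁ ⁅ edge ⁆
    unused′ e∈i e∈A′ with x∈p∩q⁻ A (∁ ⁅ edge ⁆) e∈A′ | ∈-attach⁻ trees e∈i
    ... | e∈A , _  | inj₁ e∈i′       = unused e∈i′ e∈A
    ... | _ , e∈∁  | inj₂ (_ , refl) = x∈∁p⇒x∉p e∈∁ (x∈⁅x⁆ edge)
    cover′ : ∀ e → e ∈ A ∩ ∁ ⁅ edge ⁆ ⊎ ∃[ i ] e ∈ attach trees element edge i
    cover′ e with cover e | e ≟ edge
    ... | inj₂ (i , e∈i) | _       = inj₂ (i , attach-⊇ trees element edge i e∈i)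
    ... | inj₁ e∈A | no  e≢edge    = inj₁ (x∈p∩q⁺ (e∈A , x∉p⇒x∈∁p (x≢y⇒x∉⁅y⁆ e≢edge)))
    ... | inj₁ e∈A | yes refl      = inj₂ (element , ∈-attach trees element edge)

  packing-⊥⇒decomposition : ∀ {A} → ∣ A ∣ ≡ 0 → Packing A → HasBasicRootedTreeDecomposition R M
  packing-⊥⇒decomposition {A} ∣A∣≡0 P =
    trees ,
    ((λ i j i≢j (e , e∈) → i≢j (disjoint (p∩q⊆p (trees i) (trees j) e∈) (p∩q⊆q (trees i) (trees j) e∈))) ,
     (λ e → [ (λ e∈A → contradiction (e , e∈A) (∣p∣≡0⇒Empty ∣A∣≡0)) , id ]′ (cover e))) ,
    grown⇒rootedTree ∘ grown ,
    λ v → subst IsBase (covering≡ v) (indep∧rank≤∣∣⇒base (indep v) (≤-trans (≤-reflexive rank⊤) (k≤ v)))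
    where
    open Packing P
    open Feasible feasible
    k≤ : ∀ v → k ≤ ∣ covering v ∣
    k≤ v with k ≤? ∣ covering v ∣
    ... | yes k≤ = k≤
    ... | no  k≰ = contradiction
      (begin-strict
        k * #V                                        ≡⟨ total ⟨
        ∣ A ∣ + sum (λ v → ∣ covering v ∣)            ≡⟨ cong (_+ sum (λ v → ∣ covering v ∣)) ∣A∣≡0 ⟩
        sum (λ v → ∣ covering v ∣)                    <⟨ sum-mono-< (indep⇒≤k ∘ indep) v (≰⇒> k≰) ⟩
        sum {#V} (λ _ → k)                            ≡⟨ sum-const #V k ⟩
        k * #V                                        ∎)
      (<-irrefl refl)
      where open ≤-Reasoning
    covering≡ : ∀ v → covering v ≡ subsetOf (λ i → v ∈? treeVertices (trees i) (R i))
    covering≡ v = ⊆-antisym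
      (λ {i} i∈ → ∈-subsetOf⁺ (λ i → v ∈? treeVertices (trees i) (R i))
        (⊆treeVertices (grown i) (from-covering i∈)))
      (λ {i} i∈ → to-covering (subst (v ∈_) (sym (grown⇒treeVertices (grown i)))
        (∈-subsetOf⁻ (λ i → v ∈? treeVertices (trees i) (R i)) i∈)))

  packing⇒decomposition : ∀ n {A} → ∣ A ∣ ≡ n → Packing A → HasBasicRootedTreeDecomposition R M
  packing⇒decomposition zero    ∣A∣≡ P = packing-⊥⇒decomposition ∣A∣≡ P
  packing⇒decomposition (suc n) ∣A∣≡ P with packing-step (≤-trans (s≤s z≤n) (≤-reflexive (sym ∣A∣≡))) P
  ... | A′ , eq , P′ = packing⇒decomposition n (suc-injective (trans (sym eq) ∣A∣≡)) P′

  rootsOn : Subset #V → Subset t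
  rootsOn X = subsetOf (λ i → R i ∈? X)

  ∈rootsAt⁺ : ∀ {v i} → R i ≡ v → i ∈ rootsAt R v
  ∈rootsAt⁺ {v} = ∈-subsetOf⁺ (λ i → R i ≟ v)

  ∈rootsAt⁻ : ∀ {v i} → i ∈ rootsAt R v → R i ≡ v
  ∈rootsAt⁻ {v} = ∈-subsetOf⁻ (λ i → R i ≟ v)

  count-roots : ∀ Q → sum (λ v → ∣ Q ∩ rootsAt R v ∣) ≡ ∣ Q ∣
  count-roots Q = trans
    (double-count {B = λ i → ⁅ R i ⁆}
      (λ {v} {i} i∈ → subst (_∈ ⁅ R i ⁆) (∈rootsAt⁻ i∈) (x∈⁅x⁆ (R i)))
      (λ {v} {i} v∈ → ∈rootsAt⁺ (sym (x∈⁅y⁆⇒x≡y (R i) v∈)))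
      (λ i → ∣⁅x⁆∣≡1 (R i)) Q)
    (*-identityˡ ∣ Q ∣)

  weight-roots : ∀ X → weight (rootsAt R) X ≤ ∣ rootsOn X ∣
  weight-roots X = ≤-trans (sum-mono-≤ pointwise) (≤-reflexive (count-roots (rootsOn X)))
    where
    pointwise : ∀ v → χ X v * ∣ rootsAt R v ∣ ≤ ∣ rootsOn X ∩ rootsAt R v ∣
    pointwise v with v ∈? X
    ... | no  v∉ = ≤-trans (≤-reflexive (cong (_* ∣ rootsAt R v ∣) (χ-∉ v∉))) z≤n
    ... | yes v∈ = begin
      χ X v * ∣ rootsAt R v ∣         ≡⟨ cong (_* ∣ rootsAt R v ∣) (χ-∈ v∈) ⟩
      1 * ∣ rootsAt R v ∣             ≡⟨ *-identityˡ _ ⟩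
      ∣ rootsAt R v ∣                 ≤⟨ p⊆q⇒∣p∣≤∣q∣ (λ {i} i∈ → x∈p∩q⁺
                                          (∈-subsetOf⁺ (λ i → R i ∈? X)
                                            (subst (_∈ X) (sym (∈rootsAt⁻ i∈)) v∈) , i∈)) ⟩
      ∣ rootsOn X ∩ rootsAt R v ∣     ∎
      where open ≤-Reasoning

  sufficiency : (∀ v → Indep (rootsAt R v)) →
                (∀ F → Nonempty F → ∣ F ∣ + ∣ rootsIn R F ∣ + k ≤ k * ∣ V⟨ F ⟩ ∣ + rank (rootsIn R F)) →
                #E + t ≡ k * #V → HasBasicRootedTreeDecomposition R M
  sufficiency c1 c2 c3 = packing⇒decomposition #E (∣⊤∣≡n #E) record
    { trees         = λ _ → ⊥
    ; spanned       = λ i → ⁅ R i ⁆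
    ; covering      = rootsAt R
    ; grown         = λ _ → root
    ; to-covering   = λ {i} v∈ → ∈rootsAt⁺ (sym (x∈⁅y⁆⇒x≡y (R i) v∈))
    ; from-covering = λ {v} {i} i∈ → subst (_∈ ⁅ R i ⁆) (∈rootsAt⁻ i∈) (x∈⁅x⁆ (R i))
    ; disjoint      = λ e∈ → contradiction e∈ ∉⊥
    ; unused        = λ e∈ → contradiction e∈ ∉⊥
    ; cover         = λ _ → inj₁ ∈⊤
    ; feasible      = record { indep = c1 ; total = total ; cond = cond }
    }
    where
    total : ∣ ⊤ {#E} ∣ + sum (λ v → ∣ rootsAt R v ∣) ≡ k * #V
    total = trans (cong₂ _+_ (∣⊤∣≡n #E) ∑roots) c3
      where
      ∑roots : sum (λ v → ∣ rootsAt R v ∣) ≡ t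
      ∑roots = trans (sum-cong-≗ (λ v → cong ∣_∣ (sym (∩-identityˡ (rootsAt R v)))))
                     (trans (count-roots ⊤) (∣⊤∣≡n t))

    -- A vertex outside Y adds at most k on the left and exactly k on the right.
    cond-from : ∀ {X Y} → Y ⊆ X → ∣ E[ X ] ∣ + ∣ rootsOn Y ∣ + k ≤ k * ∣ Y ∣ + rank (rootsOn Y) →
                demand ⊤ (rootsAt R) X + k ≤ k * ∣ X ∣ + rank (⋃ (rootsAt R) X)
    cond-from {X} {Y} Y⊆X bound = begin
      ∣ E[ X ] ∩ ⊤ ∣ + weight (rootsAt R) X + k
        ≤⟨ +-monoˡ-≤ k (+-mono-≤ (∣p∩q∣≤∣p∣ E[ X ] ⊤) (weight-∪ (rootsAt R) (∩∁-split Y⊆X))) ⟩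
      ∣ E[ X ] ∣ + (weight (rootsAt R) Y + weight (rootsAt R) Z) + k
        ≤⟨ +-monoˡ-≤ k (+-monoʳ-≤ ∣ E[ X ] ∣
             (+-mono-≤ (weight-roots Y) (weight-bound (rootsAt R) (indep⇒≤k ∘ c1) Z))) ⟩
      ∣ E[ X ] ∣ + (∣ rootsOn Y ∣ + k * ∣ Z ∣) + k
        ≡⟨ shuffle (∣ E[ X ] ∣) (∣ rootsOn Y ∣) (k * ∣ Z ∣) k ⟩
      (∣ E[ X ] ∣ + ∣ rootsOn Y ∣ + k) + k * ∣ Z ∣
        ≤⟨ +-monoˡ-≤ (k * ∣ Z ∣) bound ⟩
      (k * ∣ Y ∣ + rank (rootsOn Y)) + k * ∣ Z ∣
        ≡⟨ collect k (∣ Y ∣) (∣ Z ∣) (rank (rootsOn Y)) ⟩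
      k * (∣ Y ∣ + ∣ Z ∣) + rank (rootsOn Y)
        ≤⟨ +-mono-≤ (*-monoʳ-≤ k (∣q∣+∣p∩∁q∣≤∣p∣ X Y Y⊆X)) (rank-mono rootsOn⊆) ⟩
      k * ∣ X ∣ + rank (⋃ (rootsAt R) X) ∎
      where
      open ≤-Reasoning
      Z : Subset #V
      Z = X ∩ ∁ Y
      shuffle : ∀ a b c k → a + (b + c) + k ≡ (a + b + k) + c
      shuffle = solve-∀
      collect : ∀ k y z r → (k * y + r) + k * z ≡ k * (y + z) + r
      collect = solve-∀
      rootsOn⊆ : rootsOn Y ⊆ ⋃ (rootsAt R) X
      rootsOn⊆ i∈ = ∈⋃⁺ (rootsAt R) (Y⊆X (∈-subsetOf⁻ (λ i → R i ∈? Y) i∈)) (∈rootsAt⁺ refl)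

    -- If `X` induces edges, (C2) for `E[ X ]` gives the bound on the vertices these edges touch.
    -- Otherwise the bound starts from one vertex of `X`, where (C1) makes the rank of the roots
    -- equal to their number.
    cond : ∀ X → Nonempty X →
           demand ⊤ (rootsAt R) X + k ≤ k * ∣ X ∣ + rank (⋃ (rootsAt R) X)
    cond X (v , v∈X) with nonempty? E[ X ]
    ... | yes ne = cond-from (V-lub ∈E⁻) (c2 E[ X ] ne)
    ... | no  ∅  = cond-from (⁅x⁆⊆ v∈X) (begin
      ∣ E[ X ] ∣ + ∣ Q ∣ + k     ≡⟨ cong (λ F → ∣ F ∣ + ∣ Q ∣ + k) (Empty-unique ∅) ⟩
      ∣ ⊥ {#E} ∣ + ∣ Q ∣ + k     ≡⟨ cong (λ n → n + ∣ Q ∣ + k) (∣⊥∣≡0 #E) ⟩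
      ∣ Q ∣ + k                  ≡⟨ +-comm ∣ Q ∣ k ⟩
      k + ∣ Q ∣                  ≡⟨ cong₂ _+_ (sym (trans (cong (k *_) (∣⁅x⁆∣≡1 v)) (*-identityʳ k)))
                                              (sym (rank-indep (closed Q⊆ (c1 v)))) ⟩
      k * ∣ ⁅ v ⁆ ∣ + rank Q     ∎)
      where
      open ≤-Reasoning
      Q : Subset t
      Q = rootsOn ⁅ v ⁆
      Q⊆ : Q ⊆ rootsAt R v
      Q⊆ i∈ = ∈rootsAt⁺ (x∈⁅y⁆⇒x≡y v (∈-subsetOf⁻ (λ i → R i ∈? ⁅ v ⁆) i∈))

-- Necessity: counting over the trees of a decomposition.

module Necessity (G : Graph) {t : ℕ} (M : Matroid t) (k : ℕ) (rank⊤ : Matroid.rank M ⊤ ≡ k)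
                 (R : Fin t → Graph.Vertex G)
                 (decomposition : Graph.HasBasicRootedTreeDecomposition G R M) where
  open Graph G
  open GraphLemmas G
  open RootedTrees G
  open Matroid M
  open MatroidRank M

  private
    T : Fin t → Subset #E
    T = proj₁ decomposition
    partition : IsPartition T
    partition = proj₁ (proj₂ decomposition)
    U : Fin t → Subset #V
    U i = treeVertices (T i) (R i)
    grown : ∀ i → Grown (R i) (T i) (U i)
    grown i = rootedTree⇒grown (proj₁ (proj₂ (proj₂ decomposition)) i)
    B : Vertex → Subset t
    B v = subsetOf (λ i → v ∈? U i)
    base : ∀ v → IsBase (B v)
    base = proj₂ (proj₂ (proj₂ decomposition))
    ∣B∣≡k : ∀ v → ∣ B v ∣ ≡ k
    ∣B∣≡k v = trans (base⇒∣∣≡rank (base v)) rank⊤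
    U⇒B : ∀ {i v} → v ∈ U i → i ∈ B v
    U⇒B {i} {v} = ∈-subsetOf⁺ (λ i → v ∈? U i)
    B⇒U : ∀ {i v} → i ∈ B v → v ∈ U i
    B⇒U {i} {v} = ∈-subsetOf⁻ (λ i → v ∈? U i)

  ∑∣F∩T∣ : ∀ F → sum (λ i → ∣ F ∩ T i ∣) ≡ ∣ F ∣
  ∑∣F∩T∣ F = trans (double-count {B = λ e → ⁅ tree e ⁆} T⇒ ⇒T (λ e → ∣⁅x⁆∣≡1 (tree e)) F)
                   (*-identityˡ ∣ F ∣)
    where
    tree : Edge → Fin t
    tree e = proj₁ (proj₂ partition e)
    ⇒T : ∀ {i e} → i ∈ ⁅ tree e ⁆ → e ∈ T i
    ⇒T {i} {e} i∈ with refl ← x∈⁅y⁆⇒x≡y (tree e) i∈ = proj₂ (proj₂ partition e)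
    T⇒ : ∀ {i e} → e ∈ T i → i ∈ ⁅ tree e ⁆
    T⇒ {i} {e} e∈ with i ≟ tree e
    ... | yes refl = x∈⁅x⁆ i
    ... | no  i≢   = contradiction (e , x∈p∩q⁺ (e∈ , proj₂ (proj₂ partition e)))
                                   (proj₁ partition i (tree e) i≢)

  -- Every tree contains its own root, so the roots at `v` form part of the base at `v`.
  roots-indep : ∀ v → Indep (rootsAt R v)
  roots-indep v = closed (λ {i} i∈ → U⇒B (subst (_∈ U i) (∈-subsetOf⁻ (λ i → R i ≟ v) i∈) (root∈ (grown i))))
                         (proj₁ (base v))

  -- Each tree has one vertex more than it has edges, and each vertex lies on `k` trees.
  edge-count : #E + t ≡ k * #V
  edge-count = begin
    #E + t                                        ≡⟨ cong₂ _+_ ∑∣T∣ (trans (sum-const t 1) (*-identityˡ t)) ⟨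
    sum (λ i → ∣ T i ∣) + sum {t} (λ _ → 1)       ≡⟨ ∑-distrib-+ (λ i → ∣ T i ∣) (λ _ → 1) ⟨
    sum (λ i → ∣ T i ∣ + 1)                       ≡⟨ sum-cong-≗ (λ i → trans (+-comm ∣ T i ∣ 1) (sym (∣grown∣ (grown i)))) ⟩
    sum (λ i → ∣ U i ∣)                           ≡⟨ sum-cong-≗ (λ i → cong ∣_∣ (∩-identityˡ (U i))) ⟨
    sum (λ i → ∣ ⊤ ∩ U i ∣)                       ≡⟨ double-count {U = U} U⇒B B⇒U ∣B∣≡k ⊤ ⟩
    k * ∣ ⊤ {#V} ∣                                ≡⟨ cong (k *_) (∣⊤∣≡n #V) ⟩
    k * #V                                        ∎
    where
    open ≡-Reasoning
    ∑∣T∣ : sum (λ i → ∣ T i ∣) ≡ #E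
    ∑∣T∣ = trans (sum-cong-≗ (λ i → cong ∣_∣ (sym (∩-identityˡ (T i)))))
                 (trans (∑∣F∩T∣ ⊤) (∣⊤∣≡n #E))

  -- The trees that meet `V⟨ F ⟩` have full rank and include those rooted there, so
  -- `rank-deficiency` bounds `k` plus the number of roots. Each such tree has at least one vertex
  -- more in `V⟨ F ⟩` than edges in `F`.
  sparse : ∀ F → Nonempty F → ∣ F ∣ + ∣ rootsIn R F ∣ + k ≤ k * ∣ V⟨ F ⟩ ∣ + rank (rootsIn R F)
  sparse F (e , e∈F) = begin
    ∣ F ∣ + ∣ rootsIn R F ∣ + k             ≤⟨ +-monoʳ-≤ (∣ F ∣ + ∣ rootsIn R F ∣) k≤rank ⟩
    ∣ F ∣ + ∣ rootsIn R F ∣ + rank Meeting  ≡⟨ shuffle (∣ F ∣) (∣ rootsIn R F ∣) (rank Meeting) ⟩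
    ∣ F ∣ + (rank Meeting + ∣ rootsIn R F ∣) ≤⟨ +-monoʳ-≤ ∣ F ∣ (rank-deficiency roots⊆) ⟩
    ∣ F ∣ + (rank (rootsIn R F) + ∣ Meeting ∣) ≡⟨ shuffle′ (∣ F ∣) (rank (rootsIn R F)) (∣ Meeting ∣) ⟩
    (∣ F ∣ + ∣ Meeting ∣) + rank (rootsIn R F) ≤⟨ +-monoˡ-≤ (rank (rootsIn R F)) trees-bound ⟩
    k * ∣ X ∣ + rank (rootsIn R F)          ∎
    where
    open ≤-Reasoning
    X : Subset #V
    X = V⟨ F ⟩
    Meeting : Subset t
    Meeting = subsetOf (λ i → nonempty? (X ∩ U i))
    meeting⁺ : ∀ {i} → Nonempty (X ∩ U i) → i ∈ Meeting
    meeting⁺ = ∈-subsetOf⁺ (λ i → nonempty? (X ∩ U i))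
    shuffle : ∀ a b c → a + b + c ≡ a + (c + b)
    shuffle = solve-∀
    shuffle′ : ∀ a b c → a + (b + c) ≡ (a + c) + b
    shuffle′ = solve-∀
    F⊆X : ∀ {e} → e ∈ F → src e ∈ X × tgt e ∈ X
    F⊆X e∈ = ∈V⁺ e∈ (inj₁ refl) , ∈V⁺ e∈ (inj₂ refl)
    roots⊆ : rootsIn R F ⊆ Meeting
    roots⊆ {i} i∈ = meeting⁺ (R i , x∈p∩q⁺ (∈-subsetOf⁻ (λ i → R i ∈? V⟨ F ⟩) i∈ , root∈ (grown i)))
    -- The base at an end of the given edge of `F` consists of trees through a vertex of `X`.
    k≤rank : k ≤ rank Meeting
    k≤rank = ≤-trans (≤-reflexive (sym (∣B∣≡k (src e))))
      (indep⇒∣∣≤rank (proj₁ (base (src e)))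
        (λ i∈ → meeting⁺ (src e , x∈p∩q⁺ (proj₁ (F⊆X e∈F) , B⇒U i∈))))
    -- The indicator is the surplus of vertices over edges, claimed only for trees that meet `X`.
    tree-bound : ∀ i → ∣ F ∩ T i ∣ + χ Meeting i ≤ ∣ X ∩ U i ∣
    tree-bound i with nonempty? (X ∩ U i) | forest-bound (grown i) {F} {X} F⊆X
    ... | no  ∅  | inj₂ lt = contradiction
      (≤-trans lt (≤-reflexive (trans (cong ∣_∣ (Empty-unique ∅)) (∣⊥∣≡0 #V)))) λ ()
    ... | no  ∅  | inj₁ eq = ≤-trans (≤-reflexive (cong₂ _+_ eq
      (χ-∉ {p = Meeting} {i} (∅ ∘ ∈-subsetOf⁻ (λ i → nonempty? (X ∩ U i)))))) z≤n
    ... | yes ne | inj₂ lt = ≤-trans (≤-reflexive (trans (cong (∣ F ∩ T i ∣ +_) (χ-∈ (meeting⁺ ne)))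
                                                         (+-comm ∣ F ∩ T i ∣ 1))) lt
    ... | yes ne | inj₁ eq = ≤-trans (≤-reflexive (cong₂ _+_ eq (χ-∈ (meeting⁺ ne))))
                                     (n≢0⇒n>0 λ eq′ → ∣p∣≡0⇒Empty eq′ ne)
    trees-bound : ∣ F ∣ + ∣ Meeting ∣ ≤ k * ∣ X ∣
    trees-bound = begin
      ∣ F ∣ + ∣ Meeting ∣                                ≡⟨ cong₂ _+_ (sym (∑∣F∩T∣ F)) (∣∣≡∑χ Meeting) ⟩
      sum (λ i → ∣ F ∩ T i ∣) + sum (χ Meeting)          ≡⟨ ∑-distrib-+ (λ i → ∣ F ∩ T i ∣) (χ Meeting) ⟨
      sum (λ i → ∣ F ∩ T i ∣ + χ Meeting i)              ≤⟨ sum-mono-≤ tree-bound ⟩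
      sum (λ i → ∣ X ∩ U i ∣)                            ≡⟨ double-count {U = U} U⇒B B⇒U ∣B∣≡k X ⟩
      k * ∣ X ∣                                          ∎

-- Passage between the integer inequality and its subtraction-free form.

module _ (a b k v r : ℕ) where
  private
    rhs : ℤ.ℤ
    rhs = ℤ.+ k ℤ.* ℤ.+ v ℤ.- ℤ.+ k ℤ.+ ℤ.+ r

    rhs+k : rhs ℤ.+ ℤ.+ k ≡ ℤ.+ (k * v + r)
    rhs+k = trans (rearrange (ℤ.+ k ℤ.* ℤ.+ v) (ℤ.+ k) (ℤ.+ r)) (cong (ℤ._+ ℤ.+ r) (sym (ℤ.pos-* k v)))
      where
      rearrange : ∀ x y z → x ℤ.- y ℤ.+ z ℤ.+ y ≡ x ℤ.+ z
      rearrange = ℤ-Ring.solve-∀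

    +k-k : ∀ x → x ℤ.+ ℤ.+ k ℤ.+ ℤ.- ℤ.+ k ≡ x
    +k-k x = rearrange x (ℤ.+ k)
      where
      rearrange : ∀ x y → x ℤ.+ y ℤ.+ ℤ.- y ≡ x
      rearrange = ℤ-Ring.solve-∀

  ℕ⇒ℤ-bound : a + b + k ≤ k * v + r → ℤ.+ a ℤ.+ ℤ.+ b ℤ.≤ rhs
  ℕ⇒ℤ-bound le = subst₂ ℤ._≤_ (+k-k (ℤ.+ a ℤ.+ ℤ.+ b)) (trans (cong (ℤ._- ℤ.+ k) (sym rhs+k)) (+k-k rhs))
                   (ℤ.+-monoˡ-≤ (ℤ.- ℤ.+ k) (ℤ.+≤+ le))

  ℤ⇒ℕ-bound : ℤ.+ a ℤ.+ ℤ.+ b ℤ.≤ rhs → a + b + k ≤ k * v + r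
  ℤ⇒ℕ-bound le = ℤ.drop‿+≤+ (ℤ.≤-trans (ℤ.+-monoˡ-≤ (ℤ.+ k) le) (ℤ.≤-reflexive rhs+k))

theorem1p2 : (G : Graph) → let open Graph G in
    (t : ℕ) (R : Fin t → Vertex) (M : Matroid t) → let open Matroid M in
    (k : ℕ) → rank ⊤ ≡ k →
    HasBasicRootedTreeDecomposition R M ⇔
    ( (∀ v → Indep (rootsAt R v))
    × (∀ F → Nonempty F →
    ℤ.+ ∣ F ∣ ℤ.+ ℤ.+ ∣ rootsIn R F ∣
    ℤ.≤ ℤ.+ k ℤ.* ℤ.+ ∣ V⟨ F ⟩ ∣ ℤ.- ℤ.+ k ℤ.+ ℤ.+ rank (rootsIn R F))
    × (#E + t ≡ k * #V) )
theorem1p2 G t R M k rank⊤ = mk⇔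
  (λ decomposition → let open Necessity G M k rank⊤ R decomposition in
    roots-indep , (λ F ne → ℕ⇒ℤ-bound (∣ F ∣) (∣ Graph.rootsIn G R F ∣) k _ _ (sparse F ne)) , edge-count)
  (λ (c1 , c2 , c3) → Sufficiency.sufficiency G M k rank⊤ R
    c1 (λ F ne → ℤ⇒ℕ-bound (∣ F ∣) (∣ Graph.rootsIn G R F ∣) k _ _ (c2 F ne)) c3)
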